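{- For any integer $k \geq 2$, every $(k^2+2k-1)$-connected line graph $L(G)$ with $\delta(G) \geq k+1$ has $k$ completely independent spanning trees.
   Context: All graphs are finite, simple and undirected. $L(G)$ is the line graph of $G$ (vertex set $E(G)$, two vertices adjacent iff the corresponding edges share an endpoint). $\delta(G)$ is the minimum degree of $G$. A graph is $k$-connected if its (vertex) connectivity is at least $k$. Spanning trees $T_1,\dots,T_k$ of a graph $H$ are completely independent if for any two distinct vertices $u,v$ of $H$, the $u$–$v$ paths in $T_1,\dots,T_k$ are pairwise edge-disjoint and pairwise share no vertex other than $u$ and $v$. -}

module Defs where

open import Data.Nat using (ℕ; zero; suc; _+_; _≤_; _<_)
open import Data.Bool using (Bool; true; false)
open import Data.Fin using (Fin)
import Data.Fin as F
open import Data.List using (List; []; _∷_; length; map)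
open import Data.Nat.ListAction using (sum)
open import Data.List.Membership.Propositional using (_∈_; _∉_)
open import Data.List.Relation.Unary.Unique.Propositional using (Unique)
open import Data.List.Fresh using ()
open import Data.Fin.Base using ()
open import Data.Product using (Σ; ∃; _×_; _,_; proj₁; proj₂)
open import Data.Sum using (_⊎_)
open import Data.Empty using (⊥)
open import Relation.Nullary using (¬_)
open import Relation.Binary.PropositionalEquality using (_≡_; _≢_)
open import Data.List using (allFin)

record SimpleGraph (n : ℕ) : Set where
  field
    adj     : Fin n → Fin n → Bool
    adj-sym : ∀ u v → adj u v ≡ adj v u
    adj-irr : ∀ v → adj v v ≡ false
open SimpleGraph public

boolToℕ : Bool → ℕ
boolToℕ true  = 1
boolToℕ false = 0

degree : ∀ {n} → SimpleGraph n → Fin n → ℕ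
degree {n} G v = sum (map (λ w → boolToℕ (adj G v w)) (allFin n))

MinDegree≥ : ∀ {n} → SimpleGraph n → ℕ → Set
MinDegree≥ {n} G d = ∀ (v : Fin n) → d ≤ degree G v

record Graph (V : Set) : Set₁ where
  field
    Adj     : V → V → Set
    Adj-sym : ∀ {u v} → Adj u v → Adj v u
    Adj-irr : ∀ {v} → ¬ Adj v v
open Graph public

data Walk {V : Set} (E : V → V → Set) : V → V → Set where
  []  : ∀ {u} → Walk E u u
  _∷_ : ∀ {u w v} → E u w → Walk E w v → Walk E u v

verts : ∀ {V : Set} {E : V → V → Set} {u v} → Walk E u v → List V
verts {u = u} []            = u ∷ []
verts {u = u} (_ ∷ p)       = u ∷ verts p

walkLength : ∀ {V : Set} {E : V → V → Set} {u v} → Walk E u v → ℕ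
walkLength []      = 0
walkLength (_ ∷ p) = suc (walkLength p)

data UsesEdge {V : Set} {E : V → V → Set} (a b : V) :
              ∀ {u v} → Walk E u v → Set where
  here-fwd : ∀ {v} (e : E a b) (p : Walk E b v) → UsesEdge a b (e ∷ p)
  here-bwd : ∀ {v} (e : E b a) (p : Walk E a v) → UsesEdge a b (e ∷ p)
  there    : ∀ {u w v} (e : E u w) {p : Walk E w v} →
             UsesEdge a b p → UsesEdge a b (e ∷ p)

IsPath : ∀ {V : Set} {E : V → V → Set} {u v} → Walk E u v → Set
IsPath p = Unique (verts p)

Delete : ∀ {V : Set} → Graph V → List V → V → V → Set
Delete H S u w = Adj H u w × u ∉ S × w ∉ S

Connected-minus : ∀ {V : Set} → Graph V → List V → Set
Connected-minus {V} H S = ∀ (u v : V) → u ∉ S → v ∉ S → Walk (Delete H S) u v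

KConnected : ∀ {V : Set} → Graph V → ℕ → Set
KConnected {V} H k =
  (Σ (List V) λ vs → Unique vs × suc k ≤ length vs) ×
  (∀ (S : List V) → length S < k → Connected-minus H S)

record SpanningTree {V : Set} (H : Graph V) (T : V → V → Set) : Set where
  field
    sub       : ∀ {u v} → T u v → Adj H u v
    symm      : ∀ {u v} → T u v → T v u
    connected : ∀ (u v : V) → Walk T u v
    -- acyclic: no cycle u = x₀ x₁ … x_m = w (m ≥ 2, distinct) closed by wu ∈ T
    acyclic   : ∀ {u w} (p : Walk T u w) → IsPath p → 2 ≤ walkLength p →
                ¬ T w u

CompletelyIndependent : ∀ {V : Set} {k : ℕ} (H : Graph V) →
                        (Fin k → V → V → Set) → Set
CompletelyIndependent {V} {k} H T =
  (∀ i → SpanningTree H (T i)) ×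
  (∀ (i j : Fin k) → i ≢ j → ∀ (u v : V) → u ≢ v →
     ∀ (p : Walk (T i) u v) (q : Walk (T j) u v) → IsPath p → IsPath q →
       (∀ x → x ∈ verts p → x ∈ verts q → x ≡ u ⊎ x ≡ v) ×
       (∀ a b → UsesEdge a b p → UsesEdge a b q → ⊥))

-- edges of G, each stored once as (a , b) with a < b
Edge : ∀ {n} → SimpleGraph n → Set
Edge {n} G = Σ (Fin n × Fin n) λ ab → (proj₁ ab F.< proj₂ ab) × (adj G (proj₁ ab) (proj₂ ab) ≡ true)

EndpointOf : ∀ {n} {G : SimpleGraph n} → Fin n → Edge G → Set
EndpointOf x ((a , b) , _) = x ≡ a ⊎ x ≡ b

LAdj : ∀ {n} (G : SimpleGraph n) → Edge G → Edge G → Set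
LAdj {n} G e f = e ≢ f × Σ (Fin n) λ x → EndpointOf {G = G} x e × EndpointOf {G = G} x f

LineGraph : ∀ {n} (G : SimpleGraph n) → Graph (Edge G)
LineGraph G = record
  { Adj     = LAdj G
  ; Adj-sym = λ { (ne , x , ex , fx) → (λ eq → ne (sym' eq)) , x , fx , ex }
  ; Adj-irr = λ { (ne , _) → ne refl' }
  }
  where
  open import Relation.Binary.PropositionalEquality using () renaming (sym to sym'; refl to refl')

{-# OPTIONS --safe #-}
-- A packing of G into k edge-disjoint connected spanning subgraphs gives the k trees of L(G).  Turn each of the
-- subgraphs into a rooted tree of G, with pairwise distinct roots, and let the top of an edge of G be its upper
-- end if it is a tree edge (and any end otherwise).  In the i-th tree of L(G) the parent of an edge with top x
-- is the edge from x to its parent in the i-th tree of G.  Inner vertices of that tree are edges of colour i, and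
-- distinctness of the roots prevents two edges from being each other's parents in different trees.
--
-- The packing exists by the Nash-Williams–Tutte condition.  Edges are coloured one at a time so as to keep the
-- matroid union inequality; if every colour were blocked, the union of the blocking (tight) edge sets would
-- violate the inequality together with the new edge, by supermodularity of the number of components.
--
-- The condition itself, that a partition into c classes has at least k(c-1) crossing edges, follows by discharging.
-- Connectivity k²+2k-1 of L(G) says that adjacent vertices have degree sum at least k²+2k+1, and that a class
-- has at least k²+2k-1 boundary edges if there is an edge inside it and one outside it.
module Submission where

open import Axiom.UniquenessOfIdentityProofs using (module Decidable⇒UIP)
open import Data.Bool using (Bool; true; false; if_then_else_; _∧_; _∨_; not)
import Data.Bool.Properties as Bool
open import Data.Empty using (⊥; ⊥-elim)
open import Data.Fin using (Fin)
import Data.Fin as F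
import Data.Fin.Properties as F
open import Data.Fin.Subset.Properties using (anySubset?)
open import Data.List using (List; []; _∷_; _++_; length; map; allFin; concatMap; tabulate; filter; cartesianProduct)
open import Data.List.Membership.Propositional using (_∈_; _∉_; lose)
open import Data.List.Membership.Propositional.Properties using (∈-allFin; ∈-∃++; ∈-++⁻; ∈-++⁺ˡ; ∈-++⁺ʳ; ∈-concatMap⁺; ∈-filter⁺; ∈-filter⁻)
open import Data.List.Properties using (length-++; ++-assoc; ++-identityʳ; length-tabulate; length-filter)
open import Data.List.Relation.Binary.Permutation.Propositional using (_↭_; ↭-refl; ↭-sym; ↭-trans; prep)
open import Data.List.Relation.Binary.Permutation.Propositional.Properties using (shift; ∈-resp-↭; ↭-length) renaming (++⁺ʳ to ↭-++⁺ʳ)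
open import Data.List.Relation.Unary.All as All using (All; []; _∷_)
open import Data.List.Relation.Unary.All.Properties using (¬All⇒Any¬)
open import Data.List.Relation.Unary.AllPairs using ([]; _∷_)
open import Data.List.Relation.Unary.Any as Any using (here; there)
open import Data.List.Relation.Unary.Unique.Propositional using (Unique)
open import Data.List.Relation.Unary.Unique.Propositional.Properties using (allFin⁺; cartesianProduct⁺; filter⁺)
open import Data.Nat using (ℕ; zero; suc; _+_; _*_; _∸_; _≤_; _<_; z≤n; s≤s; s≤s⁻¹; _≤?_; _<?_; _≟_; NonZero; >-nonZero)
open import Data.Nat.ListAction using (sum)
open import Data.Nat.Properties
open import Data.Nat.Tactic.RingSolver using (solve-∀)
open import Data.Product using (Σ; ∃; _×_; _,_; proj₁; proj₂)
open import Data.Product.Properties using (≡-dec)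
open import Data.Sum using (_⊎_; inj₁; inj₂)
open import Data.Vec as Vec using (Vec; []; _∷_)
open import Defs
open import Function using (_∘_; id)
open import Relation.Binary.Definitions using (DecidableEquality; tri<; tri≈; tri>)
open import Relation.Binary.PropositionalEquality using (_≡_; _≢_; refl; sym; trans; cong; cong₂; subst; module ≡-Reasoning)
open import Relation.Binary.Structures using (IsEquivalence)
open import Relation.Nullary using (¬_; Dec; yes; no; does; contradiction; ¬?; _×-dec_; _⊎-dec_)
open import Relation.Nullary.Decidable using (decidable-stable)

private
  module UIP = Decidable⇒UIP Bool._≟_
  variable
    A B : Set
    n k : ℕ

-- Finite sums and lists

∑ : List A → (A → ℕ) → ℕ
∑ xs f = sum (map f xs)

⟦_⟧ : Dec A → ℕ
⟦ a? ⟧ = boolToℕ (does a?)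

⟦⟧-true : (a? : Dec A) → A → ⟦ a? ⟧ ≡ 1
⟦⟧-true (yes _) _ = refl
⟦⟧-true (no ¬a) a = contradiction a ¬a

⟦⟧-false : (a? : Dec A) → ¬ A → ⟦ a? ⟧ ≡ 0
⟦⟧-false (yes a) ¬a = contradiction a ¬a
⟦⟧-false (no _)  _  = refl

⟦⟧-mono : (a? : Dec A) (b? : Dec B) → (A → B) → ⟦ a? ⟧ ≤ ⟦ b? ⟧
⟦⟧-mono (no _)  b? f = z≤n
⟦⟧-mono (yes a) b? f = ≤-reflexive (sym (⟦⟧-true b? (f a)))

⟦⟧*≤ : (a? : Dec A) (z : ℕ) → ⟦ a? ⟧ * z ≤ z
⟦⟧*≤ (yes _) z = ≤-reflexive (+-identityʳ z)
⟦⟧*≤ (no _)  z = z≤n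

∑-cong : (xs : List A) {f g : A → ℕ} → (∀ x → f x ≡ g x) → ∑ xs f ≡ ∑ xs g
∑-cong []       p = refl
∑-cong (x ∷ xs) p = cong₂ _+_ (p x) (∑-cong xs p)

∑-mono : (xs : List A) {f g : A → ℕ} → (∀ x → f x ≤ g x) → ∑ xs f ≤ ∑ xs g
∑-mono []       p = z≤n
∑-mono (x ∷ xs) p = +-mono-≤ (p x) (∑-mono xs p)

∑-mono-< : {xs : List A} {f g : A → ℕ} {t : A} → (∀ x → f x ≤ g x) →
           t ∈ xs → f t < g t → ∑ xs f < ∑ xs g
∑-mono-< {xs = _ ∷ xs} p (here refl)  q = +-mono-<-≤ q (∑-mono xs p)
∑-mono-< {xs = x ∷ _}  p (there t∈xs) q = +-mono-≤-< (p x) (∑-mono-< p t∈xs q)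

∑-term : {xs : List A} (f : A → ℕ) {t : A} → t ∈ xs → f t ≤ ∑ xs f
∑-term f (here refl)   = m≤m+n _ _
∑-term f (there t∈xs)  = ≤-trans (∑-term f t∈xs) (m≤n+m _ _)

∑-zero : (xs : List A) → ∑ xs (λ _ → 0) ≡ 0
∑-zero []       = refl
∑-zero (_ ∷ xs) = ∑-zero xs

∑-one : (xs : List A) → ∑ xs (λ _ → 1) ≡ length xs
∑-one []       = refl
∑-one (_ ∷ xs) = cong suc (∑-one xs)

∑-distrib-+ : (xs : List A) (f g : A → ℕ) → ∑ xs (λ x → f x + g x) ≡ ∑ xs f + ∑ xs g
∑-distrib-+ []       f g = refl
∑-distrib-+ (x ∷ xs) f g = trans (cong (f x + g x +_) (∑-distrib-+ xs f g))
                                 (interchange (f x) (g x) (∑ xs f) (∑ xs g))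
  where
  interchange : ∀ a b c d → a + b + (c + d) ≡ a + c + (b + d)
  interchange = solve-∀

∑-*ʳ : (xs : List A) (f : A → ℕ) (c : ℕ) → ∑ xs (λ x → f x * c) ≡ ∑ xs f * c
∑-*ʳ []       f c = refl
∑-*ʳ (x ∷ xs) f c = trans (cong (f x * c +_) (∑-*ʳ xs f c)) (sym (*-distribʳ-+ c (f x) (∑ xs f)))

∑-*ˡ : (xs : List A) (f : A → ℕ) (c : ℕ) → ∑ xs (λ x → c * f x) ≡ c * ∑ xs f
∑-*ˡ xs f c = trans (∑-cong xs (λ x → *-comm c (f x))) (trans (∑-*ʳ xs f c) (*-comm _ c))

∑-comm : (xs : List A) (ys : List B) (f : A → B → ℕ) →
         ∑ xs (λ x → ∑ ys (f x)) ≡ ∑ ys (λ y → ∑ xs (λ x → f x y))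
∑-comm []       ys f = sym (∑-zero ys)
∑-comm (x ∷ xs) ys f = trans (cong (∑ ys (f x) +_) (∑-comm xs ys f))
                             (sym (∑-distrib-+ ys (f x) _))

∑-δ : (_≟_ : DecidableEquality A) {xs : List A} {t : A} → Unique xs → t ∈ xs →
      ∑ xs (λ x → ⟦ x ≟ t ⟧) ≡ 1
∑-δ {A = A} _≟_ {t = t} = go
  where
  absent : (xs : List A) → t ∉ xs → ∑ xs (λ x → ⟦ x ≟ t ⟧) ≡ 0
  absent []       _   = refl
  absent (x ∷ xs) t∉  = cong₂ _+_ (⟦⟧-false (x ≟ t) (λ x≡t → t∉ (here (sym x≡t))))
                                  (absent xs (t∉ ∘ there))
  go : {xs : List A} → Unique xs → t ∈ xs → ∑ xs (λ x → ⟦ x ≟ t ⟧) ≡ 1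
  go {xs = x ∷ xs} (x∉ ∷ _) (here refl) =
    cong₂ _+_ (⟦⟧-true (x ≟ t) refl) (absent xs (λ t∈ → All.lookup x∉ t∈ refl))
  go {xs = x ∷ xs} (x∉ ∷ u) (there t∈) =
    cong₂ _+_ (⟦⟧-false (x ≟ t) (All.lookup x∉ t∈)) (go u t∈)

∑-δ-allFin : (t : Fin n) → ∑ (allFin n) (λ x → ⟦ x F.≟ t ⟧) ≡ 1
∑-δ-allFin {n} t = ∑-δ F._≟_ (allFin⁺ n) (∈-allFin t)

∑-++ : (xs ys : List A) (f : A → ℕ) → ∑ (xs ++ ys) f ≡ ∑ xs f + ∑ ys f
∑-++ []       ys f = refl
∑-++ (x ∷ xs) ys f = trans (cong (f x +_) (∑-++ xs ys f)) (sym (+-assoc (f x) _ _))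

∑-map : (g : A → B) (xs : List A) (f : B → ℕ) → ∑ (map g xs) f ≡ ∑ xs (f ∘ g)
∑-map g []       f = refl
∑-map g (x ∷ xs) f = cong (f (g x) +_) (∑-map g xs f)

∑-cartesianProduct : (xs : List A) (ys : List B) (f : A × B → ℕ) →
                     ∑ (cartesianProduct xs ys) f ≡ ∑ xs (λ x → ∑ ys (λ y → f (x , y)))
∑-cartesianProduct []       ys f = refl
∑-cartesianProduct (x ∷ xs) ys f = trans (∑-++ (map (x ,_) ys) _ f)
  (cong₂ _+_ (∑-map (x ,_) ys f) (∑-cartesianProduct xs ys f))

∑-filter : {P : A → Set} (P? : ∀ x → Dec (P x)) (xs : List A) (f : A → ℕ) →
           ∑ (filter P? xs) f ≡ ∑ xs (λ x → ⟦ P? x ⟧ * f x)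
∑-filter P? []       f = refl
∑-filter P? (x ∷ xs) f with P? x
... | yes _ = cong₂ _+_ (sym (+-identityʳ (f x))) (∑-filter P? xs f)
... | no _  = ∑-filter P? xs f

length-concatMap : (f : A → List B) (xs : List A) →
                   length (concatMap f xs) ≡ ∑ xs (length ∘ f)
length-concatMap f []       = refl
length-concatMap f (x ∷ xs) = trans (length-++ (f x)) (cong (length (f x) +_) (length-concatMap f xs))

Unique-⊆-length : {xs : List A} (ys : List A) → Unique xs → (∀ {x} → x ∈ xs → x ∈ ys) →
                  length xs ≤ length ys
Unique-⊆-length {xs = []}     ys _        sub = z≤n
Unique-⊆-length {A = A} {xs = x ∷ xs} ys (x∉ ∷ u) sub with ∈-∃++ (sub (here refl))
... | ps , qs , refl = begin
  suc (length xs)            ≤⟨ s≤s (Unique-⊆-length (ps ++ qs) u sub′) ⟩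
  suc (length (ps ++ qs))    ≡⟨ cong suc (length-++ ps) ⟩
  suc (length ps + length qs) ≡⟨ +-suc (length ps) (length qs) ⟨
  length ps + suc (length qs) ≡⟨ length-++ ps ⟨
  length (ps ++ x ∷ qs)      ∎
  where
  open ≤-Reasoning
  drop-x : ∀ {y} → x ≢ y → y ∈ ps ++ x ∷ qs → y ∈ ps ++ qs
  drop-x x≢y y∈ with ∈-++⁻ ps y∈
  ... | inj₁ y∈ps          = ∈-++⁺ˡ y∈ps
  ... | inj₂ (here y≡x)    = contradiction (sym y≡x) x≢y
  ... | inj₂ (there y∈qs)  = ∈-++⁺ʳ ps y∈qs
  sub′ : ∀ {y} → y ∈ xs → y ∈ ps ++ qs
  sub′ y∈ = drop-x (All.lookup x∉ y∈) (sub (there y∈))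

pigeonhole : DecidableEquality A → {xs : List A} (ys : List A) → Unique xs →
             length ys < length xs → ∃ λ x → x ∉ ys
pigeonhole _≟_ {xs} ys u lt with All.all? (λ x → Any.any? (x ≟_) ys) xs
... | yes all  = contradiction (Unique-⊆-length ys u (All.lookup all)) (<⇒≱ lt)
... | no ¬all  = Any.satisfied (¬All⇒Any¬ (λ x → Any.any? (x ≟_) ys) xs ¬all)

-- Components of an edge list

glue : Fin n → Fin n → Fin n → Fin n
glue lo hi z = if does (z F.≟ hi) then lo else z

-- Both fields together make `l v` the least vertex of its class, since `l w ≡ l v` gives `l v ≤ w`.
-- Classes can therefore be counted as fixed points of `l`.
record Canonical (l : Fin n → Fin n) : Set where
  field
    below : ∀ v → l v F.≤ v
    idem  : ∀ v → l (l v) ≡ l v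

glue-canonical : ∀ {l : Fin n → Fin n} {lo hi} → Canonical l → l lo ≡ lo → lo F.≤ hi →
                 Canonical (glue lo hi ∘ l)
glue-canonical {l = l} {lo} {hi} can lo-fix lo≤hi = record { below = below′ ; idem = idem′ }
  where
  open Canonical can
  below′ : ∀ v → glue lo hi (l v) F.≤ v
  below′ v with l v F.≟ hi
  ... | yes eq = F.≤-trans lo≤hi (subst (F._≤ v) eq (below v))
  ... | no _   = below v
  idem′ : ∀ v → glue lo hi (l (glue lo hi (l v))) ≡ glue lo hi (l v)
  idem′ v with l v F.≟ hi
  ... | yes _ rewrite lo-fix with lo F.≟ hi
  ...   | yes _ = refl
  ...   | no _  = refl
  idem′ v | no ≢hi rewrite idem v with l v F.≟ hi
  ...   | yes eq = contradiction eq ≢hi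
  ...   | no _   = refl

glue-joins : ∀ (lo hi : Fin n) → glue lo hi lo ≡ glue lo hi hi
glue-joins lo hi with lo F.≟ hi | hi F.≟ hi
... | yes _ | yes _  = refl
... | no _  | yes _  = refl
... | _     | no ≢hi = contradiction refl ≢hi

-- Merging two classes costs exactly one representative, namely `hi`. Summed over `v`, this is the
-- loss of one component.
glue-fixed : ∀ {l : Fin n → Fin n} {lo hi} → l lo ≡ lo → l hi ≡ hi → lo ≢ hi → ∀ v →
             ⟦ l v F.≟ v ⟧ ≡ ⟦ glue lo hi (l v) F.≟ v ⟧ + ⟦ v F.≟ hi ⟧
glue-fixed {l = l} {lo} {hi} lo-fix hi-fix lo≢hi v with l v F.≟ hi
... | no lv≢hi = sym (trans (cong (⟦ l v F.≟ v ⟧ +_) (⟦⟧-false (v F.≟ hi) λ { refl → lv≢hi hi-fix }))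
                            (+-identityʳ _))
... | yes refl = trans flip (cong (_+ ⟦ v F.≟ l v ⟧)
                   (sym (⟦⟧-false (lo F.≟ v) λ { refl → lo≢hi (sym lo-fix) })))
  where
  flip : ⟦ l v F.≟ v ⟧ ≡ ⟦ v F.≟ l v ⟧
  flip = ≤-antisym (⟦⟧-mono (l v F.≟ v) (v F.≟ l v) sym) (⟦⟧-mono (v F.≟ l v) (l v F.≟ v) sym)

glue-related : ∀ {E : Fin n → Fin n → Set} → IsEquivalence E → ∀ {lo hi v w} →
               E lo hi → E v w → E v (glue lo hi w)
glue-related eqv {hi = hi} {w = w} E-lohi E-vw with w F.≟ hi
... | yes refl = IsEquivalence.trans eqv E-vw (IsEquivalence.sym eqv E-lohi)
... | no _     = E-vw

-- lab L v is the least vertex in the component of v in the graph with edge list L.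
lab : List (Fin n × Fin n) → Fin n → Fin n
lab []            v = v
lab ((a , b) ∷ L) v with F.≤-total (lab L a) (lab L b)
... | inj₁ _ = glue (lab L a) (lab L b) (lab L v)
... | inj₂ _ = glue (lab L b) (lab L a) (lab L v)

lab-canonical : (L : List (Fin n × Fin n)) → Canonical (lab L)
lab-canonical []            = record { below = λ _ → ≤-refl ; idem = λ _ → refl }
lab-canonical ((a , b) ∷ L) with F.≤-total (lab L a) (lab L b)
... | inj₁ le = glue-canonical (lab-canonical L) (Canonical.idem (lab-canonical L) a) le
... | inj₂ le = glue-canonical (lab-canonical L) (Canonical.idem (lab-canonical L) b) le

lab-below : (L : List (Fin n × Fin n)) → ∀ v → lab L v F.≤ v
lab-below L = Canonical.below (lab-canonical L)

lab-idem : (L : List (Fin n × Fin n)) → ∀ v → lab L (lab L v) ≡ lab L v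
lab-idem L = Canonical.idem (lab-canonical L)

lab-related : ∀ {E : Fin n → Fin n → Set} → IsEquivalence E → (L : List (Fin n × Fin n)) →
              (∀ {a b} → (a , b) ∈ L → E a b) → ∀ v → E v (lab L v)
lab-related {E = E} eqv [] _ v = IsEquivalence.refl eqv
lab-related {E = E} eqv ((a , b) ∷ L) L⊆E v with F.≤-total (lab L a) (lab L b)
... | inj₁ _ = glue-related {E = E} eqv ab (lab-related eqv L (L⊆E ∘ there) v)
  where
  open IsEquivalence eqv using () renaming (sym to E-sym; trans to E-trans)
  ab : E (lab L a) (lab L b)
  ab = E-trans (E-sym (lab-related eqv L (L⊆E ∘ there) a))
         (E-trans (L⊆E (here refl)) (lab-related eqv L (L⊆E ∘ there) b))
... | inj₂ _ = glue-related {E = E} eqv ba (lab-related eqv L (L⊆E ∘ there) v)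
  where
  open IsEquivalence eqv using () renaming (sym to E-sym; trans to E-trans)
  ba : E (lab L b) (lab L a)
  ba = E-trans (E-sym (lab-related eqv L (L⊆E ∘ there) b))
         (E-trans (E-sym (L⊆E (here refl))) (lab-related eqv L (L⊆E ∘ there) a))

Joined : List (Fin n × Fin n) → Fin n → Fin n → Set
Joined L u v = lab L u ≡ lab L v

Joined-isEquivalence : (L : List (Fin n × Fin n)) → IsEquivalence (Joined L)
Joined-isEquivalence L = record { refl = refl ; sym = sym ; trans = trans }

-- Universal property of the component relation. It is applied with the components of a larger edge
-- list as `E`, and later with an equivalence about reachability from a root.
Joined-least : ∀ {E : Fin n → Fin n → Set} → IsEquivalence E → (L : List (Fin n × Fin n)) →
               (∀ {a b} → (a , b) ∈ L → E a b) → ∀ {u v} → Joined L u v → E u v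
Joined-least {E = E} eqv L L⊆E {u} {v} eq =
  E-trans (subst (E u) eq (lab-related eqv L L⊆E u)) (E-sym (lab-related eqv L L⊆E v))
  where open IsEquivalence eqv using () renaming (sym to E-sym; trans to E-trans)

Joined-∷ : ∀ e (L : List (Fin n × Fin n)) {u v} → Joined L u v → Joined (e ∷ L) u v
Joined-∷ (a , b) L eq with F.≤-total (lab L a) (lab L b)
... | inj₁ _ = cong (glue (lab L a) (lab L b)) eq
... | inj₂ _ = cong (glue (lab L b) (lab L a)) eq

Joined-∈ : (L : List (Fin n × Fin n)) → ∀ {a b} → (a , b) ∈ L → Joined L a b
Joined-∈ ((a , b) ∷ L) (here refl) with F.≤-total (lab L a) (lab L b)
... | inj₁ _ = glue-joins (lab L a) (lab L b)
... | inj₂ _ = sym (glue-joins (lab L b) (lab L a))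
Joined-∈ (e ∷ L) (there ab∈L) = Joined-∷ e L (Joined-∈ L ab∈L)

Joined-⊆ : (L L′ : List (Fin n × Fin n)) → (∀ {e} → e ∈ L → e ∈ L′) → ∀ {u v} →
           Joined L u v → Joined L′ u v
Joined-⊆ L L′ L⊆L′ = Joined-least (Joined-isEquivalence L′) L (Joined-∈ L′ ∘ L⊆L′)

components : List (Fin n × Fin n) → ℕ
components {n} L = ∑ (allFin n) (λ v → ⟦ lab L v F.≟ v ⟧)

-- A representative of the coarser partition is least in its class, hence least in the finer class
-- that contains it, and so a representative there as well.
components-anti : (L L′ : List (Fin n × Fin n)) → (∀ {u v} → Joined L u v → Joined L′ u v) →
                  components L′ ≤ components L
components-anti {n} L L′ sub = ∑-mono (allFin n) λ v → ⟦⟧-mono (lab L′ v F.≟ v) (lab L v F.≟ v) (fixed v)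
  where
  fixed : ∀ v → lab L′ v ≡ v → lab L v ≡ v
  fixed v eq = F.≤-antisym (lab-below L v)
    (subst (F._≤ lab L v) (trans (sub (lab-idem L v)) eq) (lab-below L′ (lab L v)))

components-⊆ : (L L′ : List (Fin n × Fin n)) → (∀ {e} → e ∈ L → e ∈ L′) → components L′ ≤ components L
components-⊆ L L′ L⊆L′ = components-anti L L′ (Joined-⊆ L L′ L⊆L′)

components-∷-joined : ∀ {a b} (L : List (Fin n × Fin n)) → Joined L a b →
                      components L ≤ components ((a , b) ∷ L)
components-∷-joined L ab = components-anti (_ ∷ L) L
  (Joined-least (Joined-isEquivalence L) (_ ∷ L) λ { (here refl) → ab ; (there p) → Joined-∈ L p })

components-∷-apart : ∀ {a b} (L : List (Fin n × Fin n)) → ¬ Joined L a b →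
                     components L ≡ components ((a , b) ∷ L) + 1
components-∷-apart {n} {a} {b} L apart with F.≤-total (lab L a) (lab L b)
... | inj₁ _ = trans (∑-cong (allFin n) (glue-fixed {l = lab L} (lab-idem L a) (lab-idem L b) apart))
                 (trans (∑-distrib-+ (allFin n) _ _) (cong (∑ (allFin n) (λ v → ⟦ glue (lab L a) (lab L b) (lab L v) F.≟ v ⟧) +_) (∑-δ-allFin (lab L b))))
... | inj₂ _ = trans (∑-cong (allFin n) (glue-fixed {l = lab L} (lab-idem L b) (lab-idem L a) (apart ∘ sym)))
                 (trans (∑-distrib-+ (allFin n) _ _) (cong (∑ (allFin n) (λ v → ⟦ glue (lab L b) (lab L a) (lab L v) F.≟ v ⟧) +_) (∑-δ-allFin (lab L a))))

components-∷-≤ : ∀ e (L : List (Fin n × Fin n)) → components (e ∷ L) ≤ components L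
components-∷-≤ e L = components-⊆ L (e ∷ L) there

components-≥1 : Fin n → (L : List (Fin n × Fin n)) → 1 ≤ components L
components-≥1 v L = ≤-trans (≤-reflexive (sym (⟦⟧-true (lab L (lab L v) F.≟ lab L v) (lab-idem L v))))
                            (∑-term (λ u → ⟦ lab L u F.≟ u ⟧) (∈-allFin (lab L v)))

components-≤1⇒Joined : (L : List (Fin n × Fin n)) → components L ≤ 1 → ∀ u v → Joined L u v
components-≤1⇒Joined {n} L c≤1 u v with lab L u F.≟ lab L v
... | yes eq = eq
... | no neq = contradiction (≤-trans two c≤1) λ { (s≤s ()) }
  where
  pointwise : ∀ x → ⟦ x F.≟ lab L u ⟧ + ⟦ x F.≟ lab L v ⟧ ≤ ⟦ lab L x F.≟ x ⟧
  pointwise x with x F.≟ lab L u | x F.≟ lab L v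
  ... | yes p    | yes q    = contradiction (trans (sym p) q) neq
  ... | yes refl | no _     = ≤-reflexive (sym (⟦⟧-true (lab L (lab L u) F.≟ lab L u) (lab-idem L u)))
  ... | no _     | yes refl = ≤-reflexive (sym (⟦⟧-true (lab L (lab L v) F.≟ lab L v) (lab-idem L v)))
  ... | no _     | no _     = z≤n
  two : 2 ≤ components L
  two = begin
    1 + 1 ≡⟨ cong₂ _+_ (sym (∑-δ-allFin (lab L u))) (sym (∑-δ-allFin (lab L v))) ⟩
    ∑ (allFin n) (λ x → ⟦ x F.≟ lab L u ⟧) + ∑ (allFin n) (λ x → ⟦ x F.≟ lab L v ⟧)
      ≡⟨ ∑-distrib-+ (allFin n) _ _ ⟨
    ∑ (allFin n) (λ x → ⟦ x F.≟ lab L u ⟧ + ⟦ x F.≟ lab L v ⟧)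
      ≤⟨ ∑-mono (allFin n) pointwise ⟩
    components L ∎
    where open ≤-Reasoning

-- Diminishing returns: an edge of `D` that merges two components on top of the larger list `X` also
-- merges two on top of `I`. The edges of `D` are added one by one.
components-++ : (D I X : List (Fin n × Fin n)) → (∀ {e} → e ∈ I → e ∈ X) →
                components (D ++ I) + components X ≤ components I + components (D ++ X)
components-++ []            I X I⊆X = ≤-refl
components-++ ((a , b) ∷ D) I X I⊆X with lab (D ++ X) a F.≟ lab (D ++ X) b
... | yes joined = begin
    components ((a , b) ∷ D ++ I) + components X ≤⟨ +-monoˡ-≤ _ (components-∷-≤ (a , b) (D ++ I)) ⟩
    components (D ++ I) + components X           ≤⟨ components-++ D I X I⊆X ⟩
    components I + components (D ++ X)           ≤⟨ +-monoʳ-≤ (components I) (components-∷-joined (D ++ X) joined) ⟩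
    components I + components ((a , b) ∷ D ++ X) ∎
    where open ≤-Reasoning
... | no apart = +-cancelʳ-≤ 1 _ _ (begin
    components ((a , b) ∷ D ++ I) + components X + 1   ≡⟨ swap _ (components X) 1 ⟩
    (components ((a , b) ∷ D ++ I) + 1) + components X ≡⟨ cong (_+ components X) (components-∷-apart (D ++ I) (apart ∘ Joined-⊆ (D ++ I) (D ++ X) D++I⊆)) ⟨
    components (D ++ I) + components X                 ≤⟨ components-++ D I X I⊆X ⟩
    components I + components (D ++ X)                 ≡⟨ cong (components I +_) (components-∷-apart (D ++ X) apart) ⟩
    components I + (components ((a , b) ∷ D ++ X) + 1) ≡⟨ +-assoc (components I) _ 1 ⟨
    components I + components ((a , b) ∷ D ++ X) + 1   ∎)
    where
    open ≤-Reasoning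
    swap : ∀ x y z → x + y + z ≡ (x + z) + y
    swap = solve-∀
    D++I⊆ : ∀ {e} → e ∈ D ++ I → e ∈ D ++ X
    D++I⊆ e∈ with ∈-++⁻ D e∈
    ... | inj₁ e∈D = ∈-++⁺ˡ e∈D
    ... | inj₂ e∈I = ∈-++⁺ʳ D (I⊆X e∈I)

-- Tree packing

-- Sets of edges are masks over the positions of a list. Union, intersection and difference become
-- pointwise, and the finitely many masks can be searched for a violated inequality.
select : (R : List A) → Vec Bool (length R) → List A
select []      []          = []
select (x ∷ R) (true  ∷ M) = x ∷ select R M
select (x ∷ R) (false ∷ M) = select R M

infixr 6 _∪_ _∩_ _─_
_∪_ _∩_ _─_ : ∀ {m} → Vec Bool m → Vec Bool m → Vec Bool m
_∪_ = Vec.zipWith _∨_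
_∩_ = Vec.zipWith _∧_
_─_ = Vec.zipWith (λ a b → a ∧ not b)

select-∪ : (R : List A) (M N : Vec Bool (length R)) →
           select R (M ∪ N) ↭ select R (N ─ M) ++ select R M
select-∪ []      []          []          = ↭-refl
select-∪ (x ∷ R) (true  ∷ M) (true  ∷ N) = ↭-trans (prep x (select-∪ R M N)) (↭-sym (shift x (select R (N ─ M)) _))
select-∪ (x ∷ R) (true  ∷ M) (false ∷ N) = ↭-trans (prep x (select-∪ R M N)) (↭-sym (shift x (select R (N ─ M)) _))
select-∪ (x ∷ R) (false ∷ M) (true  ∷ N) = prep x (select-∪ R M N)
select-∪ (x ∷ R) (false ∷ M) (false ∷ N) = select-∪ R M N

select-split : (R : List A) (M N : Vec Bool (length R)) →
               select R N ↭ select R (N ─ M) ++ select R (M ∩ N)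
select-split []      []          []          = ↭-refl
select-split (x ∷ R) (true  ∷ M) (true  ∷ N) = ↭-trans (prep x (select-split R M N)) (↭-sym (shift x (select R (N ─ M)) _))
select-split (x ∷ R) (true  ∷ M) (false ∷ N) = select-split R M N
select-split (x ∷ R) (false ∷ M) (true  ∷ N) = prep x (select-split R M N)
select-split (x ∷ R) (false ∷ M) (false ∷ N) = select-split R M N

select-∩ : (R : List A) (M N : Vec Bool (length R)) → ∀ {x} → x ∈ select R (M ∩ N) → x ∈ select R M
select-∩ []      []          []          ()
select-∩ (y ∷ R) (true  ∷ M) (true  ∷ N) (here eq)  = here eq
select-∩ (y ∷ R) (true  ∷ M) (true  ∷ N) (there x∈) = there (select-∩ R M N x∈)
select-∩ (y ∷ R) (true  ∷ M) (false ∷ N) x∈         = there (select-∩ R M N x∈)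
select-∩ (y ∷ R) (false ∷ M) (_     ∷ N) x∈         = select-∩ R M N x∈

components-↭ : {L L′ : List (Fin n × Fin n)} → L ↭ L′ → components L ≡ components L′
components-↭ {L = L} {L′} p = ≤-antisym (components-⊆ L′ L (∈-resp-↭ (↭-sym p))) (components-⊆ L L′ (∈-resp-↭ p))

-- Passing from `M ∩ N` to `N` and from `M` to `M ∪ N` adds the same edges `N ─ M`, so this is an
-- instance of the diminishing returns in `components-++`.
components-supermodular : (R F : List (Fin n × Fin n)) (M N : Vec Bool (length R)) →
  components (select R M ++ F) + components (select R N ++ F) ≤
  components (select R (M ∩ N) ++ F) + components (select R (M ∪ N) ++ F)
components-supermodular R F M N = begin
  components (select R M ++ F) + components (select R N ++ F)
    ≡⟨ cong (components (select R M ++ F) +_) (components-↭ (reassoc (select R (N ─ M)) _ (select-split R M N))) ⟩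
  components (select R M ++ F) + components (select R (N ─ M) ++ select R (M ∩ N) ++ F)
    ≡⟨ +-comm (components (select R M ++ F)) _ ⟩
  components (select R (N ─ M) ++ select R (M ∩ N) ++ F) + components (select R M ++ F)
    ≤⟨ components-++ (select R (N ─ M)) (select R (M ∩ N) ++ F) (select R M ++ F) ∩⊆ ⟩
  components (select R (M ∩ N) ++ F) + components (select R (N ─ M) ++ select R M ++ F)
    ≡⟨ cong (components (select R (M ∩ N) ++ F) +_) (components-↭ (reassoc (select R (N ─ M)) _ (select-∪ R M N))) ⟨
  components (select R (M ∩ N) ++ F) + components (select R (M ∪ N) ++ F) ∎
  where
  open ≤-Reasoning
  reassoc : ∀ {P} Q S → P ↭ Q ++ S → P ++ F ↭ Q ++ S ++ F
  reassoc {P} Q S p = subst (P ++ F ↭_) (++-assoc Q S F) (↭-++⁺ʳ F p)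
  ∩⊆ : ∀ {e} → e ∈ select R (M ∩ N) ++ F → e ∈ select R M ++ F
  ∩⊆ e∈ with ∈-++⁻ (select R (M ∩ N)) e∈
  ... | inj₁ e∈s = ∈-++⁺ˡ (select-∩ R M N e∈s)
  ... | inj₂ e∈F = ∈-++⁺ʳ (select R M) e∈F

length-select-modular : (R : List A) (M N : Vec Bool (length R)) →
  length (select R M) + length (select R N) ≡ length (select R (M ∩ N)) + length (select R (M ∪ N))
length-select-modular R M N = begin
  length (select R M) + length (select R N)
    ≡⟨ cong (length (select R M) +_) (trans (↭-length (select-split R M N)) (length-++ (select R (N ─ M)))) ⟩
  length (select R M) + (length (select R (N ─ M)) + length (select R (M ∩ N)))
    ≡⟨ rotate (length (select R M)) (length (select R (N ─ M))) (length (select R (M ∩ N))) ⟩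
  length (select R (M ∩ N)) + (length (select R (N ─ M)) + length (select R M))
    ≡⟨ cong (length (select R (M ∩ N)) +_) (trans (↭-length (select-∪ R M N)) (length-++ (select R (N ─ M)))) ⟨
  length (select R (M ∩ N)) + length (select R (M ∪ N)) ∎
  where
  open ≡-Reasoning
  rotate : ∀ x y z → x + (y + z) ≡ z + (y + x)
  rotate = solve-∀

-- The matroid union inequality

Forests : ℕ → ℕ → Set
Forests n k = Fin k → List (Fin n × Fin n)

-- With `F i` contracted, the selected edges have rank `components (F i)` minus
-- `components (select R M ++ F i)`. In the matroid union formula these ranks and the number of
-- unselected edges must together reach the sum of the full ranks `components (F i)` minus 1.
-- Collecting the negative terms on one side gives `load`, to be bounded by `length R + k`.
load : (R : List (Fin n × Fin n)) → Forests n k → Vec Bool (length R) → ℕ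
load {k = k} R F M = ∑ (allFin k) (λ i → components (select R M ++ F i)) + length (select R M)

-- By the matroid union theorem, this is exactly the condition under which the edges of R can be
-- distributed over the edge sets F i so that each of them becomes connected.
Packable : (R : List (Fin n × Fin n)) → Forests n k → Set
Packable {k = k} R F = ∀ M → load R F M ≤ length R + k

load-supermodular : (R : List (Fin n × Fin n)) (F : Forests n k) (M N : Vec Bool (length R)) →
                    load R F M + load R F N ≤ load R F (M ∩ N) + load R F (M ∪ N)
load-supermodular {k = k} R F M N = begin
  load R F M + load R F N
    ≡⟨ interchange (S M) (length (select R M)) (S N) (length (select R N)) ⟩
  (S M + S N) + (length (select R M) + length (select R N))
    ≡⟨ cong₂ _+_ (sym (∑-distrib-+ (allFin k) _ _)) (length-select-modular R M N) ⟩
  ∑ (allFin k) (λ i → components (select R M ++ F i) + components (select R N ++ F i))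
    + (length (select R (M ∩ N)) + length (select R (M ∪ N)))
    ≤⟨ +-monoˡ-≤ _ (∑-mono (allFin k) (λ i → components-supermodular R (F i) M N)) ⟩
  ∑ (allFin k) (λ i → components (select R (M ∩ N) ++ F i) + components (select R (M ∪ N) ++ F i))
    + (length (select R (M ∩ N)) + length (select R (M ∪ N)))
    ≡⟨ cong (_+ (length (select R (M ∩ N)) + length (select R (M ∪ N)))) (∑-distrib-+ (allFin k) _ _) ⟩
  (S (M ∩ N) + S (M ∪ N)) + (length (select R (M ∩ N)) + length (select R (M ∪ N)))
    ≡⟨ interchange (S (M ∩ N)) (length (select R (M ∩ N))) (S (M ∪ N)) (length (select R (M ∪ N))) ⟨
  load R F (M ∩ N) + load R F (M ∪ N) ∎
  where
  open ≤-Reasoning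
  S : Vec Bool (length R) → ℕ
  S M = ∑ (allFin k) (λ i → components (select R M ++ F i))
  interchange : ∀ a b c d → a + b + (c + d) ≡ a + c + (b + d)
  interchange = solve-∀

assign : Forests n k → Fin k → Fin n × Fin n → Forests n k
assign F i e j = if does (j F.≟ i) then e ∷ F j else F j

module _ (a b : Fin n) (R : List (Fin n × Fin n)) (F : Forests n (suc k))
         (packable : Packable ((a , b) ∷ R) F) where

  private
    e : Fin n × Fin n
    e = a , b

    -- Packability of `e ∷ R`, at the masks that omit `e`, bounds `load R F M` from above by this
    -- same number, so tightness means equality.
    Tight : Vec Bool (length R) → Set
    Tight M = suc (length R + suc k) ≤ load R F M

    Spans : Vec Bool (length R) → Fin (suc k) → Set
    Spans M i = Joined (select R M ++ F i) a b

    insert-⊆ : ∀ {i} (L : List (Fin n × Fin n)) → ∀ {f} → f ∈ L ++ F i → f ∈ L ++ e ∷ F i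
    insert-⊆ L f∈ with ∈-++⁻ L f∈
    ... | inj₁ f∈L = ∈-++⁺ˡ f∈L
    ... | inj₂ f∈F = ∈-++⁺ʳ L (there f∈F)

    assign-≤ : ∀ M i j → components (select R M ++ assign F i e j) ≤ components (select R M ++ F j)
    assign-≤ M i j with j F.≟ i
    ... | yes _ = components-⊆ _ _ (insert-⊆ (select R M))
    ... | no _  = ≤-refl

    assign-< : ∀ M i → ¬ Spans M i → components (select R M ++ assign F i e i) < components (select R M ++ F i)
    assign-< M i apart with i F.≟ i
    ... | no i≢i = contradiction refl i≢i
    ... | yes _  = ≤-reflexive (trans (+-comm 1 _) (trans (cong (_+ 1) (components-↭ (shift e (select R M) (F i))))
                                        (sym (components-∷-apart (select R M ++ F i) apart))))

    -- Giving `e` to colour `i` never raises the load, so a violating mask was tight before. Had `M`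
    -- and `F i` left the ends of `e` apart, the load would have dropped by at least one, which is
    -- all that the new bound demands.
    violator : ∀ i M → ¬ (load R (assign F i e) M ≤ length R + suc k) → Tight M × Spans M i
    violator i M viol = ≤-trans (≰⇒> viol) (+-monoˡ-≤ _ (∑-mono (allFin (suc k)) (assign-≤ M i))) , spans
      where
      spans : Spans M i
      spans = decidable-stable (lab (select R M ++ F i) a F.≟ lab (select R M ++ F i) b) λ apart →
        viol (s≤s⁻¹ (≤-trans (+-monoˡ-< (length (select R M))
                        (∑-mono-< (assign-≤ M i) (∈-allFin i) (assign-< M i apart)))
                      (packable (false ∷ M))))

    -- Uncrossing: by supermodularity the loads of intersection and union add up to at least twice
    -- the bound. The intersection cannot exceed the bound, so the union reaches it.
    Tight-∪ : ∀ {M N} → Tight M → Tight N → Tight (M ∪ N)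
    Tight-∪ {M} {N} tM tN = +-cancelˡ-≤ (suc (length R + suc k)) _ _ (begin
      suc (length R + suc k) + suc (length R + suc k) ≤⟨ +-mono-≤ tM tN ⟩
      load R F M + load R F N                         ≤⟨ load-supermodular R F M N ⟩
      load R F (M ∩ N) + load R F (M ∪ N)             ≤⟨ +-monoˡ-≤ _ (packable (false ∷ (M ∩ N))) ⟩
      suc (length R + suc k) + load R F (M ∪ N)       ∎)
      where open ≤-Reasoning

    Spans-∪ˡ : ∀ {M N i} → Spans M i → Spans (M ∪ N) i
    Spans-∪ˡ {M} {N} {i} = Joined-⊆ _ _ sub
      where
      sub : ∀ {f} → f ∈ select R M ++ F i → f ∈ select R (M ∪ N) ++ F i
      sub f∈ with ∈-++⁻ (select R M) f∈
      ... | inj₁ f∈s = ∈-++⁺ˡ (∈-resp-↭ (↭-sym (select-∪ R M N)) (∈-++⁺ʳ (select R (N ─ M)) f∈s))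
      ... | inj₂ f∈F = ∈-++⁺ʳ (select R (M ∪ N)) f∈F

    Spans-∪ʳ : ∀ {M N i} → Spans N i → Spans (M ∪ N) i
    Spans-∪ʳ {M} {N} {i} = Joined-⊆ _ _ sub
      where
      sub : ∀ {f} → f ∈ select R N ++ F i → f ∈ select R (M ∪ N) ++ F i
      sub f∈ with ∈-++⁻ (select R N) f∈
      ... | inj₂ f∈F = ∈-++⁺ʳ (select R (M ∪ N)) f∈F
      ... | inj₁ f∈s with ∈-++⁻ (select R (N ─ M)) (∈-resp-↭ (select-split R M N) f∈s)
      ...   | inj₁ f∈d = ∈-++⁺ˡ (∈-resp-↭ (↭-sym (select-∪ R M N)) (∈-++⁺ˡ f∈d))
      ...   | inj₂ f∈i = ∈-++⁺ˡ (∈-resp-↭ (↭-sym (select-∪ R M N)) (∈-++⁺ʳ (select R (N ─ M)) (select-∩ R M N f∈i)))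

    -- Tightness and joining the ends of `e` both pass to unions, so the blocking masks of all
    -- colours merge into one.
    collect : (∀ i → ∃ λ M → Tight M × Spans M i) → ∀ i is → ∃ λ M → Tight M × All (Spans M) (i ∷ is)
    collect viol i []       = let M , t , s = viol i in M , t , s ∷ []
    collect viol i (j ∷ js) =
      let M , t , s   = viol i
          N , t′ , ss = collect viol j js
      in M ∪ N , Tight-∪ t t′ , Spans-∪ˡ {M} {N} {i} s ∷ All.map (λ {x} → Spans-∪ʳ {M} {N} {x}) ss

    -- If the ends of `e` are already joined in every colour, adding `e` to `M` lowers no component
    -- count and raises the size by one, beyond the bound at `true ∷ M`.
    overloaded : ¬ (∃ λ M → Tight M × (∀ i → Spans M i))
    overloaded (M , tight , spans) = <⇒≱ (s≤s tight) (≤-trans (begin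
      suc (load R F M)
        ≡⟨ +-suc _ (length (select R M)) ⟨
      ∑ (allFin (suc k)) (λ i → components (select R M ++ F i)) + suc (length (select R M))
        ≤⟨ +-monoˡ-≤ _ (∑-mono (allFin (suc k)) (λ i → components-∷-joined (select R M ++ F i) (spans i))) ⟩
      load (e ∷ R) F (true ∷ M) ∎) (packable (true ∷ M)))
      where open ≤-Reasoning

  assign-edge : ∃ λ i → Packable R (assign F i e)
  assign-edge with F.any? (λ i → ¬? (violated? i))
    where
    violated? : ∀ i → Dec (∃ λ M → ¬ (load R (assign F i e) M ≤ length R + suc k))
    violated? i = anySubset? λ M → ¬? (load R (assign F i e) M ≤? length R + suc k)
  ... | yes (i , ¬viol) = i , λ M → decidable-stable (_ ≤? _) λ ¬le → ¬viol (M , ¬le)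
  ... | no ¬ok = ⊥-elim (overloaded (M , tight , λ i → All.lookup spans (∈-allFin i)))
    where
    viol : ∀ i → ∃ λ M → Tight M × Spans M i
    viol i with anySubset? (λ M → ¬? (load R (assign F i e) M ≤? length R + suc k))
    ... | yes (M , v) = M , violator i M v
    ... | no ¬v       = contradiction (i , ¬v) ¬ok
    union = collect viol F.zero (tabulate F.suc)
    M     = proj₁ union
    tight = proj₁ (proj₂ union)
    spans = proj₂ (proj₂ union)

colourClass : (R : List A) → Vec (Fin k) (length R) → Fin k → List A
colourClass []      []      i = []
colourClass (x ∷ R) (c ∷ D) i = if does (i F.≟ c) then x ∷ colourClass R D i else colourClass R D i

colourClass-⊆ : (R : List A) (D : Vec (Fin k) (length R)) → ∀ {x i} → x ∈ colourClass R D i → x ∈ R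
colourClass-⊆ []      []      ()
colourClass-⊆ (y ∷ R) (c ∷ D) {i = i} x∈ with i F.≟ c
colourClass-⊆ (y ∷ R) (c ∷ D) (here eq)  | yes _ = here eq
colourClass-⊆ (y ∷ R) (c ∷ D) (there x∈) | yes _ = there (colourClass-⊆ R D x∈)
colourClass-⊆ (y ∷ R) (c ∷ D) x∈         | no _  = there (colourClass-⊆ R D x∈)

colourClass-disjoint : {R : List A} → Unique R → (D : Vec (Fin k) (length R)) → ∀ {x i j} →
                       x ∈ colourClass R D i → x ∈ colourClass R D j → i ≡ j
colourClass-disjoint {R = []}    _        []      () q
colourClass-disjoint {R = y ∷ R} (y∉ ∷ u) (c ∷ D) {x} {i} {j} p q with i F.≟ c | j F.≟ c
... | yes refl | yes refl = refl
... | no _     | no _     = colourClass-disjoint u D p q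
colourClass-disjoint {R = y ∷ R} (y∉ ∷ u) (c ∷ D) (there p) q | yes _ | no _ = colourClass-disjoint u D p q
colourClass-disjoint {R = y ∷ R} (y∉ ∷ u) (c ∷ D) (here refl) q | yes _ | no _ =
  contradiction refl (All.lookup y∉ (colourClass-⊆ R D q))
colourClass-disjoint {R = y ∷ R} (y∉ ∷ u) (c ∷ D) p (there q) | no _ | yes _ = colourClass-disjoint u D p q
colourClass-disjoint {R = y ∷ R} (y∉ ∷ u) (c ∷ D) p (here refl) | no _ | yes _ =
  contradiction refl (All.lookup y∉ (colourClass-⊆ R D p))

-- Induction on the uncoloured edges. When none is left, packability bounds the sum of the component
-- counts by the number of colours. Each count is at least 1, thanks to the vertex `v`, so each is
-- exactly 1.
packing : Fin n → (R : List (Fin n × Fin n)) (F : Forests n (suc k)) → Packable R F →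
          ∃ λ (D : Vec (Fin (suc k)) (length R)) → ∀ i → components (colourClass R D i ++ F i) ≤ 1
packing {k = k} v [] F packable = [] , λ i → ≮⇒≥ λ 1<c → <⇒≱ (begin-strict
    suc k                                     ≡⟨ length-tabulate {n = suc k} id ⟨
    length (allFin (suc k))                   ≡⟨ ∑-one (allFin (suc k)) ⟨
    ∑ (allFin (suc k)) (λ _ → 1)              <⟨ ∑-mono-< (λ j → components-≥1 v (F j)) (∈-allFin i) 1<c ⟩
    ∑ (allFin (suc k)) (λ j → components (F j)) ∎)
    (≤-trans (m≤m+n _ 0) (packable []))
  where open ≤-Reasoning
packing {k = k} v ((a , b) ∷ R) F packable with assign-edge a b R F packable
... | c , packable′ with packing v R (assign F c (a , b)) packable′
...   | D , conn = c ∷ D , λ i → ≤-trans (components-⊆ _ _ (λ {f} → sub i {f})) (conn i)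
  where
  sub : ∀ i {f} → f ∈ colourClass R D i ++ assign F c (a , b) i → f ∈ colourClass ((a , b) ∷ R) (c ∷ D) i ++ F i
  sub i f∈ with i F.≟ c
  ... | no _  = f∈
  ... | yes _ = ∈-resp-↭ (shift (a , b) (colourClass R D i) (F i)) f∈

-- The line graph

restrict : Dec A → List B → List B
restrict a? xs = if does a? then xs else []

length-restrict : (a? : Dec A) (xs : List B) → length (restrict a? xs) ≡ ⟦ a? ⟧ * length xs
length-restrict (yes _) xs = sym (+-identityʳ (length xs))
length-restrict (no _)  xs = refl

∈-restrict : (a? : Dec A) → A → ∀ {x : B} {xs} → x ∈ xs → x ∈ restrict a? xs
∈-restrict (yes _) _ x∈ = x∈
∈-restrict (no ¬a) a _  = contradiction a ¬a

module LineGraphEdges (G : SimpleGraph n) where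

  private
    End : Fin n → Edge G → Set
    End = EndpointOf {G = G}

  adj⇒≢ : ∀ {x y} → adj G x y ≡ true → x ≢ y
  adj⇒≢ {x} xy refl with () ← trans (sym xy) (adj-irr G x)

  Edge-≡ : {e f : Edge G} → proj₁ e ≡ proj₁ f → e ≡ f
  Edge-≡ {_ , lt , a} {_ , lt′ , a′} refl =
    cong₂ (λ p q → _ , p , q) (≤-irrelevant lt lt′) (UIP.≡-irrelevant a a′)

  infix 4 _≟ᵉ_
  _≟ᵉ_ : DecidableEquality (Edge G)
  e ≟ᵉ f with ≡-dec F._≟_ F._≟_ (proj₁ e) (proj₁ f)
  ... | yes eq = yes (Edge-≡ eq)
  ... | no neq = no (neq ∘ cong proj₁)

  edge : ∀ x y → adj G x y ≡ true → Edge G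
  edge x y xy with F.<-cmp x y
  ... | tri< x<y _ _ = (x , y) , x<y , xy
  ... | tri≈ _ x≡y _ = contradiction x≡y (adj⇒≢ xy)
  ... | tri> _ _ y<x = (y , x) , y<x , trans (adj-sym G y x) xy

  edge-endˡ : ∀ {x y} (xy : adj G x y ≡ true) → End x (edge x y xy)
  edge-endˡ {x} {y} xy with F.<-cmp x y
  ... | tri< _ _ _   = inj₁ refl
  ... | tri≈ _ x≡y _ = contradiction x≡y (adj⇒≢ xy)
  ... | tri> _ _ _   = inj₂ refl

  edge-endʳ : ∀ {x y} (xy : adj G x y ≡ true) → End y (edge x y xy)
  edge-endʳ {x} {y} xy with F.<-cmp x y
  ... | tri< _ _ _   = inj₂ refl
  ... | tri≈ _ x≡y _ = contradiction x≡y (adj⇒≢ xy)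
  ... | tri> _ _ _   = inj₁ refl

  edge-ends : ∀ {x y} (xy : adj G x y ≡ true) {z} → End z (edge x y xy) → z ≡ x ⊎ z ≡ y
  edge-ends {x} {y} xy z∈ with F.<-cmp x y
  ... | tri< _ _ _   = z∈
  ... | tri≈ _ x≡y _ = contradiction x≡y (adj⇒≢ xy)
  edge-ends {x} {y} xy (inj₁ p) | tri> _ _ _ = inj₂ p
  edge-ends {x} {y} xy (inj₂ p) | tri> _ _ _ = inj₁ p

  ends-determine : ∀ {x y} (e f : Edge G) → x ≢ y → End x e → End y e → End x f → End y f → e ≡ f
  ends-determine e f x≢y (inj₁ refl) (inj₁ refl) _ _ = contradiction refl x≢y
  ends-determine e f x≢y (inj₂ refl) (inj₂ refl) _ _ = contradiction refl x≢y
  ends-determine e f x≢y _ _ (inj₁ refl) (inj₁ refl) = contradiction refl x≢y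
  ends-determine e f x≢y _ _ (inj₂ refl) (inj₂ refl) = contradiction refl x≢y
  ends-determine e f x≢y (inj₁ refl) (inj₂ refl) (inj₁ refl) (inj₂ refl) = Edge-≡ refl
  ends-determine e f x≢y (inj₂ refl) (inj₁ refl) (inj₂ refl) (inj₁ refl) = Edge-≡ refl
  ends-determine (_ , lt , _) (_ , lt′ , _) x≢y (inj₁ refl) (inj₂ refl) (inj₂ refl) (inj₁ refl) = contradiction lt′ (<-asym lt)
  ends-determine (_ , lt , _) (_ , lt′ , _) x≢y (inj₂ refl) (inj₁ refl) (inj₁ refl) (inj₂ refl) = contradiction lt′ (<-asym lt)

  edge-sym : ∀ {x y} (xy : adj G x y ≡ true) (yx : adj G y x ≡ true) → edge x y xy ≡ edge y x yx
  edge-sym xy yx = ends-determine _ _ (adj⇒≢ xy) (edge-endˡ xy) (edge-endʳ xy) (edge-endʳ yx) (edge-endˡ yx)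

  edge-fst-snd : (e : Edge G) (xy : adj G (proj₁ (proj₁ e)) (proj₂ (proj₁ e)) ≡ true) → e ≡ edge _ _ xy
  edge-fst-snd e xy = ends-determine e _ (adj⇒≢ xy) (inj₁ refl) (inj₂ refl) (edge-endˡ xy) (edge-endʳ xy)

  other-end : ∀ {v} (e : Edge G) → End v e → ∃ λ z → Σ (adj G v z ≡ true) λ vz → e ≡ edge v z vz
  other-end e@((a , b) , _ , ab) (inj₁ refl) = b , ab , edge-fst-snd e ab
  other-end e@((a , b) , _ , ab) (inj₂ refl) = a , ba , trans (edge-fst-snd e ab) (edge-sym ab ba)
    where ba = trans (adj-sym G b a) ab

  -- The Boolean comes with its equation, because the edge produced in the true case carries a proof
  -- of adjacency.
  edgesOf : (x y : Fin n) (b : Bool) → adj G x y ≡ b → List (Edge G)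
  edgesOf x y true  xy = edge x y xy ∷ []
  edgesOf x y false _  = []

  edgeBetween : Fin n → Fin n → List (Edge G)
  edgeBetween x y = edgesOf x y (adj G x y) refl

  length-edgeBetween : ∀ x y → length (edgeBetween x y) ≡ boolToℕ (adj G x y)
  length-edgeBetween x y = go (adj G x y) refl
    where
    go : ∀ b eq → length (edgesOf x y b eq) ≡ boolToℕ b
    go true  _ = refl
    go false _ = refl

  ∈-edgeBetween : ∀ {x y} (xy : adj G x y ≡ true) → edge x y xy ∈ edgeBetween x y
  ∈-edgeBetween {x} {y} xy = go (adj G x y) refl
    where
    go : ∀ b eq → edge x y xy ∈ edgesOf x y b eq
    go true  eq = here (cong (edge x y) (UIP.≡-irrelevant xy eq))
    go false eq with () ← trans (sym xy) eq

  module _ {C : Fin n → Set} (C? : ∀ x → Dec (C x)) where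

    boundarySize : ℕ
    boundarySize = ∑ (allFin n) λ x → ⟦ C? x ⟧ * ∑ (allFin n) λ y → ⟦ ¬? (C? y) ⟧ * boolToℕ (adj G x y)

    private
      leaving : Fin n → List (Edge G)
      leaving x = concatMap (λ y → restrict (¬? (C? y)) (edgeBetween x y)) (allFin n)

    boundary : List (Edge G)
    boundary = concatMap (λ x → restrict (C? x) (leaving x)) (allFin n)

    length-boundary : length boundary ≡ boundarySize
    length-boundary = trans (length-concatMap _ (allFin n)) (∑-cong (allFin n) λ x →
      trans (length-restrict (C? x) (leaving x)) (cong (⟦ C? x ⟧ *_)
        (trans (length-concatMap _ (allFin n)) (∑-cong (allFin n) λ y →
          trans (length-restrict (¬? (C? y)) (edgeBetween x y)) (cong (⟦ ¬? (C? y) ⟧ *_) (length-edgeBetween x y))))))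

    ∈-boundary : ∀ {x y} (xy : adj G x y ≡ true) → C x → ¬ C y → edge x y xy ∈ boundary
    ∈-boundary {x} {y} xy cx ¬cy = ∈-concatMap⁺ (λ x → restrict (C? x) (leaving x)) (lose (∈-allFin x)
      (∈-restrict (C? x) cx (∈-concatMap⁺ (λ y → restrict (¬? (C? y)) (edgeBetween x y)) (lose (∈-allFin y)
        (∈-restrict (¬? (C? y)) ¬cy (∈-edgeBetween xy))))))

  starWithout : Fin n → Fin n → List (Edge G)
  starWithout x y = concatMap (λ z → restrict (¬? (z F.≟ y)) (edgeBetween x z)) (allFin n)

  ∈-starWithout : ∀ {x y z} (xz : adj G x z ≡ true) → z ≢ y → edge x z xz ∈ starWithout x y
  ∈-starWithout {x} {y} {z} xz z≢y = ∈-concatMap⁺ (λ z → restrict (¬? (z F.≟ y)) (edgeBetween x z))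
    (lose (∈-allFin z) (∈-restrict (¬? (z F.≟ y)) z≢y (∈-edgeBetween xz)))

  length-starWithout : ∀ {x y} → adj G x y ≡ true → length (starWithout x y) + 1 ≤ degree G x
  length-starWithout {x} {y} xy = begin
    length (starWithout x y) + 1
      ≡⟨ cong₂ _+_ (length-concatMap _ (allFin n)) (sym (∑-δ-allFin y)) ⟩
    ∑ (allFin n) (λ z → length (restrict (¬? (z F.≟ y)) (edgeBetween x z))) + ∑ (allFin n) (λ z → ⟦ z F.≟ y ⟧)
      ≡⟨ ∑-distrib-+ (allFin n) _ _ ⟨
    ∑ (allFin n) (λ z → length (restrict (¬? (z F.≟ y)) (edgeBetween x z)) + ⟦ z F.≟ y ⟧)
      ≤⟨ ∑-mono (allFin n) pointwise ⟩
    degree G x ∎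
    where
    open ≤-Reasoning
    pointwise : ∀ z → length (restrict (¬? (z F.≟ y)) (edgeBetween x z)) + ⟦ z F.≟ y ⟧ ≤ boolToℕ (adj G x z)
    pointwise z with z F.≟ y
    ... | yes refl = ≤-reflexive (cong boolToℕ (sym xy))
    ... | no _     = ≤-reflexive (trans (+-identityʳ _) (length-edgeBetween x z))

  module Connectivity (m : ℕ) (conn : KConnected (LineGraph G) m) where

    -- A property that adjacency off `S` preserves spreads along walks off `S`. If it holds at one
    -- survivor and fails at another, `S` is a separator.
    cut : (P : Edge G → Set) (S : List (Edge G)) →
          (∀ {e f} → LAdj G e f → e ∉ S → f ∉ S → P e → P f) →
          ∀ {e f} → e ∉ S → f ∉ S → P e → ¬ P f → m ≤ length S
    cut P S step {e} {f} e∉ f∉ Pe ¬Pf = ≮⇒≥ λ lt → ¬Pf (go (proj₂ conn S lt e f e∉ f∉) Pe)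
      where
      go : ∀ {e f} → Walk (Delete (LineGraph G) S) e f → P e → P f
      go []                     Pe = Pe
      go ((ef , e∉ , f∉) ∷ p) Pe = go p (step ef e∉ f∉ Pe)

    -- The boundary separates `xy` from `uv` in the line graph: an edge that meets an edge inside
    -- `C` has an end in `C`, so it lies inside `C` or crosses.
    boundary-≥ : {C : Fin n → Set} (C? : ∀ x → Dec (C x)) → ∀ {x y u v} →
                 adj G x y ≡ true → C x → C y → adj G u v ≡ true → ¬ C u → ¬ C v →
                 m ≤ boundarySize C?
    boundary-≥ {C} C? {x} {y} {u} {v} xy cx cy uv ¬cu ¬cv = begin
      m                                    ≤⟨ cut Inside S step xy∉S uv∉S inside-xy outside-uv ⟩
      length S                             ≤⟨ length-filter crossing? (boundary C?) ⟩
      length (boundary C?)                 ≡⟨ length-boundary C? ⟩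
      boundarySize C?                      ∎
      where
      open ≤-Reasoning
      Inside Crossing : Edge G → Set
      Inside   e = ∀ z → End z e → C z
      Crossing ((a , b) , _) = (C a × ¬ C b) ⊎ (¬ C a × C b)
      crossing? : ∀ e → Dec (Crossing e)
      crossing? ((a , b) , _) = (C? a ×-dec ¬? (C? b)) ⊎-dec (¬? (C? a) ×-dec C? b)
      S : List (Edge G)
      -- Filtering only shortens the list, and it makes every member of `S` cross by construction,
      -- which keeps both given edges out of `S`.
      S = filter crossing? (boundary C?)
      crossing∈S : ∀ e → Crossing e → e ∈ S
      crossing∈S e@((a , b) , _ , ab) cr@(inj₁ (ca , ¬cb)) =
        ∈-filter⁺ crossing? (subst (_∈ boundary C?) (sym (edge-fst-snd e ab)) (∈-boundary C? ab ca ¬cb)) cr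
      crossing∈S e@((a , b) , _ , ab) cr@(inj₂ (¬ca , cb)) =
        ∈-filter⁺ crossing? (subst (_∈ boundary C?) (sym (proj₂ (proj₂ (other-end e (inj₂ refl)))))
          (∈-boundary C? _ cb ¬ca)) cr
      step : ∀ {e f} → LAdj G e f → e ∉ S → f ∉ S → Inside e → Inside f
      step {e} {f} (_ , w , w∈e , w∈f) _ f∉S inside z z∈f with C? z
      ... | yes cz = cz
      ... | no ¬cz = contradiction (crossing∈S f (crosses w∈f z∈f)) f∉S
        where
        crosses : End w f → End z f → Crossing f
        crosses (inj₁ refl) (inj₁ refl) = contradiction (inside w w∈e) ¬cz
        crosses (inj₁ refl) (inj₂ refl) = inj₁ (inside w w∈e , ¬cz)
        crosses (inj₂ refl) (inj₁ refl) = inj₂ (¬cz , inside w w∈e)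
        crosses (inj₂ refl) (inj₂ refl) = contradiction (inside w w∈e) ¬cz
      inside-xy : Inside (edge x y xy)
      inside-xy z z∈ with edge-ends xy z∈
      ... | inj₁ refl = cx
      ... | inj₂ refl = cy
      outside-uv : ¬ Inside (edge u v uv)
      outside-uv inside = ¬cu (inside u (edge-endˡ uv))
      xy∉S : edge x y xy ∉ S
      xy∉S e∈ with proj₂ (∈-filter⁻ crossing? {xs = boundary C?} e∈)
      ... | inj₁ (_ , ¬c) = ¬c (inside-xy _ (inj₂ refl))
      ... | inj₂ (¬c , _) = ¬c (inside-xy _ (inj₁ refl))
      all-out : ∀ {z} → End z (edge u v uv) → ¬ C z
      all-out z∈ with edge-ends uv z∈
      ... | inj₁ refl = ¬cu
      ... | inj₂ refl = ¬cv
      uv∉S : edge u v uv ∉ S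
      uv∉S e∈ with proj₂ (∈-filter⁻ crossing? {xs = boundary C?} e∈)
      ... | inj₁ (c , _) = all-out (inj₁ refl) c
      ... | inj₂ (_ , c) = all-out (inj₂ refl) c

    -- Deleting the line graph neighbours of `xy` isolates it. At most `degree G x` minus 1 of them
    -- pass through `x`, and at most `degree G y` minus 1 through `y`.
    degree-sum : ∀ {x y} → adj G x y ≡ true → m + 2 ≤ degree G x + degree G y
    degree-sum {x} {y} xy = begin
      m + 2
        ≤⟨ +-monoˡ-≤ 2 (≤-trans m≤ (length-filter (λ f → ¬? (f ≟ᵉ e)) (starWithout x y ++ starWithout y x))) ⟩
      length (starWithout x y ++ starWithout y x) + 2
        ≡⟨ trans (cong (_+ 2) (length-++ (starWithout x y))) (split (length (starWithout x y)) (length (starWithout y x))) ⟩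
      (length (starWithout x y) + 1) + (length (starWithout y x) + 1)
        ≤⟨ +-mono-≤ (length-starWithout xy) (length-starWithout yx) ⟩
      degree G x + degree G y ∎
      where
      open ≤-Reasoning
      split : ∀ a b → a + b + 2 ≡ (a + 1) + (b + 1)
      split = solve-∀
      yx : adj G y x ≡ true
      yx = trans (adj-sym G y x) xy
      e : Edge G
      e = edge x y xy
      S : List (Edge G)
      S = filter (λ f → ¬? (f ≟ᵉ e)) (starWithout x y ++ starWithout y x)
      neighbour∈S : ∀ f v → End v e → End v f → f ≢ e → f ∈ S
      neighbour∈S f v v∈e v∈f f≢e = ∈-filter⁺ (λ f → ¬? (f ≟ᵉ e)) (f∈ v∈e (other-end f v∈f)) f≢e
        where
        f∈ : End v e → (∃ λ z → Σ (adj G v z ≡ true) λ vz → f ≡ edge v z vz) → f ∈ starWithout x y ++ starWithout y x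
        f∈ v∈e (z , vz , refl) with edge-ends xy v∈e
        ... | inj₁ refl = ∈-++⁺ˡ (∈-starWithout vz λ { refl → f≢e (cong (edge v z) (UIP.≡-irrelevant vz xy)) })
        ... | inj₂ refl = ∈-++⁺ʳ (starWithout x y) (∈-starWithout vz λ { refl → f≢e (edge-sym vz xy) })
      e∉S : e ∉ S
      e∉S e∈ = proj₂ (∈-filter⁻ (λ f → ¬? (f ≟ᵉ e)) {xs = starWithout x y ++ starWithout y x} e∈) refl
      m≤ : m ≤ length S
      m≤ = ≮⇒≥ λ lt →
        -- Some further vertex of the line graph must be cut off from `e`. There are more than `m`
        -- vertices, while `e ∷ S` has at most `m` entries if `length S < m`.
        let vs , unique , len = proj₁ conn
            f , f∉ = pigeonhole _≟ᵉ_ (e ∷ S) unique (≤-trans (s≤s lt) len)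
        in <⇒≱ lt (cut (_≡ e) S
             (λ { {f = g} (g≢e , v , v∈e , v∈g) _ g∉S refl →
                  ⊥-elim (g∉S (neighbour∈S g v v∈e v∈g (g≢e ∘ sym))) })
             e∉S (f∉ ∘ there) refl (λ f≡e → f∉ (here f≡e)))

-- Discharging

length-select-≤ : {P : A → Set} (P? : ∀ x → Dec (P x)) (R : List A) (M : Vec Bool (length R)) →
                  (∀ {x} → x ∈ select R M → ¬ P x) →
                  length (select R M) + ∑ R (λ x → ⟦ P? x ⟧) ≤ length R
length-select-≤ P? []      []          _    = z≤n
length-select-≤ P? (x ∷ R) (true ∷ M)  none rewrite ⟦⟧-false (P? x) (none (here refl)) =
  s≤s (length-select-≤ P? R M (none ∘ there))
length-select-≤ P? (x ∷ R) (false ∷ M) none with P? x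
... | yes _ = ≤-trans (≤-reflexive (+-suc _ _)) (s≤s (length-select-≤ P? R M none))
... | no _  = ≤-trans (length-select-≤ P? R M none) (n≤1+n _)

module Charging (G : SimpleGraph n) where

  isEdge? : (xy : Fin n × Fin n) → Dec (proj₁ xy F.< proj₂ xy × adj G (proj₁ xy) (proj₂ xy) ≡ true)
  isEdge? (x , y) = (x F.<? y) ×-dec (adj G x y Bool.≟ true)

  edgePairs : List (Fin n × Fin n)
  edgePairs = filter isEdge? (cartesianProduct (allFin n) (allFin n))

  weight : Fin n → Fin n → ℕ
  weight x y = boolToℕ (adj G x y)

  module _ (l : Fin n → Fin n) where

    crossing? : (xy : Fin n × Fin n) → Dec (l (proj₁ xy) ≢ l (proj₂ xy))
    crossing? (x , y) = ¬? (l x F.≟ l y)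

    crossings : ℕ
    crossings = ∑ edgePairs (λ e → ⟦ crossing? e ⟧)

    classCharge : (Fin n → Fin n → ℕ) → Fin n → ℕ
    classCharge ψ t = ∑ (allFin n) λ x → ⟦ l x F.≟ t ⟧ * ∑ (allFin n) λ y → ⟦ ¬? (l y F.≟ t) ⟧ * (weight x y * ψ x y)

    -- Each crossing edge xy hands out at most c, namely ψ x y to the class of x and ψ y x to that of y.
    module _ (ψ : Fin n → Fin n → ℕ) (c : ℕ)
             (ψ-≤ : ∀ x y → adj G x y ≡ true → l x ≢ l y → ψ x y + ψ y x ≤ c) where
      private
        V : List (Fin n)
        V = allFin n

        g : Fin n → Fin n → ℕ
        g x y = ⟦ ¬? (l x F.≟ l y) ⟧ * (weight x y * ψ x y)

        g-diagonal : ∀ x → g x x ≡ 0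
        g-diagonal x = cong (_* (weight x x * ψ x x)) (⟦⟧-false (¬? (l x F.≟ l x)) (λ neq → neq refl))

        g≤ψ : ∀ x y → g x y ≤ ψ x y
        g≤ψ x y = ≤-trans (⟦⟧*≤ (¬? (l x F.≟ l y)) _) (bool≤ (adj G x y))
          where
          bool≤ : ∀ b → boolToℕ b * ψ x y ≤ ψ x y
          bool≤ true  = ≤-reflexive (+-identityʳ _)
          bool≤ false = z≤n

        g-nonadjacent : ∀ x y → adj G x y ≢ true → g x y ≡ 0
        g-nonadjacent x y ¬xy with adj G x y
        ... | true  = contradiction refl ¬xy
        ... | false = *-zeroʳ ⟦ ¬? (l x F.≟ l y) ⟧

        g-joined : ∀ x y → l x ≡ l y → g x y ≡ 0
        g-joined x y eq = cong (_* (weight x y * ψ x y)) (⟦⟧-false (¬? (l x F.≟ l y)) (λ neq → neq eq))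

        -- `g` lives on ordered pairs, `edgePairs` only on increasing ones. Splitting each term by
        -- the order of its arguments lets both halves be regrouped over `x < y`; the diagonal
        -- vanishes.
        orient : ∀ x y → g x y ≤ ⟦ x F.<? y ⟧ * g x y + ⟦ y F.<? x ⟧ * g x y
        orient x y with F.<-cmp x y
        ... | tri≈ _ refl _ = ≤-trans (≤-reflexive (g-diagonal x)) z≤n
        ... | tri< x<y _ _ rewrite ⟦⟧-true (x F.<? y) x<y = ≤-trans (m≤m+n (g x y) 0) (m≤m+n _ _)
        ... | tri> _ _ y<x rewrite ⟦⟧-true (y F.<? x) y<x = ≤-trans (m≤m+n (g x y) 0) (m≤n+m _ (⟦ x F.<? y ⟧ * g x y))

        oriented-≤ : ∀ x y → ⟦ x F.<? y ⟧ * (g x y + g y x) ≤ c * (⟦ isEdge? (x , y) ⟧ * ⟦ crossing? (x , y) ⟧)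
        oriented-≤ x y = by-cases (x F.<? y) (adj G x y Bool.≟ true) (l x F.≟ l y)
          where
          by-cases : (d₁ : Dec (x F.< y)) (d₂ : Dec (adj G x y ≡ true)) (d₃ : Dec (l x ≡ l y)) →
                     ⟦ d₁ ⟧ * (g x y + g y x) ≤ c * (⟦ d₁ ×-dec d₂ ⟧ * ⟦ ¬? d₃ ⟧)
          by-cases (no _)  _       _       = z≤n
          by-cases (yes _) (no ¬xy) _      rewrite g-nonadjacent x y ¬xy | g-nonadjacent y x (¬xy ∘ trans (adj-sym G x y)) = z≤n
          by-cases (yes _) (yes _) (yes eq) rewrite g-joined x y eq | g-joined y x (sym eq) = z≤n
          by-cases (yes _) (yes xy) (no neq) = begin
            g x y + g y x + 0 ≡⟨ +-identityʳ _ ⟩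
            g x y + g y x     ≤⟨ +-mono-≤ (g≤ψ x y) (g≤ψ y x) ⟩
            ψ x y + ψ y x     ≤⟨ ψ-≤ x y xy neq ⟩
            c                 ≡⟨ *-identityʳ c ⟨
            c * 1             ∎
            where open ≤-Reasoning

        ∑g-≤ : ∑ V (λ x → ∑ V (g x)) ≤ c * crossings
        ∑g-≤ = begin
          ∑ V (λ x → ∑ V (g x))
            ≤⟨ ∑-mono V (λ x → ∑-mono V (orient x)) ⟩
          ∑ V (λ x → ∑ V (λ y → ⟦ x F.<? y ⟧ * g x y + ⟦ y F.<? x ⟧ * g x y))
            ≡⟨ trans (∑-cong V (λ x → ∑-distrib-+ V _ _)) (∑-distrib-+ V _ _) ⟩
          ∑ V (λ x → ∑ V (λ y → ⟦ x F.<? y ⟧ * g x y)) + ∑ V (λ x → ∑ V (λ y → ⟦ y F.<? x ⟧ * g x y))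
            ≡⟨ cong (∑ V (λ x → ∑ V (λ y → ⟦ x F.<? y ⟧ * g x y)) +_) (∑-comm V V (λ x y → ⟦ y F.<? x ⟧ * g x y)) ⟩
          ∑ V (λ x → ∑ V (λ y → ⟦ x F.<? y ⟧ * g x y)) + ∑ V (λ x → ∑ V (λ y → ⟦ x F.<? y ⟧ * g y x))
            ≡⟨ trans (∑-cong V (λ x → ∑-distrib-+ V _ _)) (∑-distrib-+ V _ _) ⟨
          ∑ V (λ x → ∑ V (λ y → ⟦ x F.<? y ⟧ * g x y + ⟦ x F.<? y ⟧ * g y x))
            ≡⟨ ∑-cong V (λ x → ∑-cong V (λ y → sym (*-distribˡ-+ ⟦ x F.<? y ⟧ (g x y) (g y x)))) ⟩
          ∑ V (λ x → ∑ V (λ y → ⟦ x F.<? y ⟧ * (g x y + g y x)))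
            ≤⟨ ∑-mono V (λ x → ∑-mono V (oriented-≤ x)) ⟩
          ∑ V (λ x → ∑ V (λ y → c * (⟦ isEdge? (x , y) ⟧ * ⟦ crossing? (x , y) ⟧)))
            ≡⟨ trans (∑-cong V (λ x → ∑-*ˡ V _ c)) (∑-*ˡ V _ c) ⟩
          c * ∑ V (λ x → ∑ V (λ y → ⟦ isEdge? (x , y) ⟧ * ⟦ crossing? (x , y) ⟧))
            ≡⟨ cong (c *_) (trans (∑-filter isEdge? (cartesianProduct V V) _) (∑-cartesianProduct V V _)) ⟨
          c * crossings ∎
          where open ≤-Reasoning

        -- Only the class of `x` collects `ψ x y`. The indicator on the right has `t` on the left,
        -- the form that `∑-δ-allFin` sums away.
        collapse : ∀ x y t → ⟦ l x F.≟ t ⟧ * (⟦ ¬? (l y F.≟ t) ⟧ * (weight x y * ψ x y)) ≤ ⟦ t F.≟ l x ⟧ * g x y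
        collapse x y t with l x F.≟ t
        ... | no _     = z≤n
        ... | yes refl rewrite ⟦⟧-true (l x F.≟ l x) refl = +-monoˡ-≤ 0 (*-monoˡ-≤ (weight x y * ψ x y)
                           (⟦⟧-mono (¬? (l y F.≟ l x)) (¬? (l x F.≟ l y)) (λ neq → neq ∘ sym)))

        ∑classCharge-≤ : ∑ V (classCharge ψ) ≤ ∑ V (λ x → ∑ V (g x))
        ∑classCharge-≤ = begin
          ∑ V (classCharge ψ)
            ≡⟨ ∑-comm V V _ ⟩
          ∑ V (λ x → ∑ V (λ t → ⟦ l x F.≟ t ⟧ * ∑ V (λ y → ⟦ ¬? (l y F.≟ t) ⟧ * (weight x y * ψ x y))))
            ≡⟨ ∑-cong V (λ x → ∑-cong V (λ t → sym (∑-*ˡ V _ ⟦ l x F.≟ t ⟧))) ⟩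
          ∑ V (λ x → ∑ V (λ t → ∑ V (λ y → ⟦ l x F.≟ t ⟧ * (⟦ ¬? (l y F.≟ t) ⟧ * (weight x y * ψ x y)))))
            ≡⟨ ∑-cong V (λ x → ∑-comm V V _) ⟩
          ∑ V (λ x → ∑ V (λ y → ∑ V (λ t → ⟦ l x F.≟ t ⟧ * (⟦ ¬? (l y F.≟ t) ⟧ * (weight x y * ψ x y)))))
            ≤⟨ ∑-mono V (λ x → ∑-mono V (λ y → ∑-mono V (collapse x y))) ⟩
          ∑ V (λ x → ∑ V (λ y → ∑ V (λ t → ⟦ t F.≟ l x ⟧ * g x y)))
            ≡⟨ ∑-cong V (λ x → ∑-cong V (λ y → trans (∑-*ʳ V _ (g x y)) (trans (cong (_* g x y) (∑-δ-allFin (l x))) (+-identityʳ (g x y))))) ⟩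
          ∑ V (λ x → ∑ V (g x)) ∎
          where open ≤-Reasoning

      -- Double counting of the charge: a crossing edge gives at most `c`, and every class collects
      -- at least `d`, except perhaps the one labelled `t₀`, whose share is lent by the final
      -- summand.
      charging : ∀ (d : ℕ) (t₀ : Fin n) →
                 (∀ t → l t ≡ t → d ≤ classCharge ψ t + ⟦ t F.≟ t₀ ⟧ * d) →
                 ∑ (allFin n) (λ t → ⟦ l t F.≟ t ⟧) * d ≤ c * crossings + d
      charging d t₀ enough = begin
        ∑ V (λ t → ⟦ l t F.≟ t ⟧) * d
          ≡⟨ ∑-*ʳ V _ d ⟨
        ∑ V (λ t → ⟦ l t F.≟ t ⟧ * d)
          ≤⟨ ∑-mono V pointwise ⟩
        ∑ V (λ t → classCharge ψ t + ⟦ t F.≟ t₀ ⟧ * d)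
          ≡⟨ ∑-distrib-+ V _ _ ⟩
        ∑ V (classCharge ψ) + ∑ V (λ t → ⟦ t F.≟ t₀ ⟧ * d)
          ≡⟨ cong (∑ V (classCharge ψ) +_) (trans (∑-*ʳ V _ d) (trans (cong (_* d) (∑-δ-allFin t₀)) (+-identityʳ d))) ⟩
        ∑ V (classCharge ψ) + d
          ≤⟨ +-monoˡ-≤ d (≤-trans ∑classCharge-≤ ∑g-≤) ⟩
        c * crossings + d ∎
        where
        open ≤-Reasoning
        pointwise : ∀ t → ⟦ l t F.≟ t ⟧ * d ≤ classCharge ψ t + ⟦ t F.≟ t₀ ⟧ * d
        pointwise t = by-case (l t F.≟ t)
          where
          by-case : (d? : Dec (l t ≡ t)) → ⟦ d? ⟧ * d ≤ classCharge ψ t + ⟦ t F.≟ t₀ ⟧ * d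
          by-case (yes fixed) = ≤-trans (≤-reflexive (+-identityʳ d)) (enough t fixed)
          by-case (no _)      = z≤n

-- For polynomial inequalities: the difference `r` is given explicitly, in `j` with `k = j + 2`
-- where `2 ≤ k` matters, so that the ring solver can check the identity.
≡⇒≤ : ∀ {a b} r → a + r ≡ b → a ≤ b
≡⇒≤ r eq = ≤-trans (m≤m+n _ r) (≤-reflexive eq)

2k≤k²+2 : ∀ {k} → 2 ≤ k → 2 * k ≤ k * k + 2
2k≤k²+2 (s≤s (s≤s {n = j} z≤n)) = ≡⇒≤ (j * j + 2 * j + 2) (eq j)
  where
  eq : ∀ j → 2 * suc (suc j) + (j * j + 2 * j + 2) ≡ suc (suc j) * suc (suc j) + 2
  eq = solve-∀

k+1<k²+2 : ∀ {k} → 2 ≤ k → k + 1 < k * k + 2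
k+1<k²+2 (s≤s (s≤s {n = j} z≤n)) = ≡⇒≤ (j * j + 3 * j + 2) (eq j)
  where
  eq : ∀ j → suc (suc (suc j) + 1) + (j * j + 3 * j + 2) ≡ suc (suc j) * suc (suc j) + 2
  eq = solve-∀

k+1<2k : ∀ {k} → 2 ≤ k → k + 1 < 2 * k
k+1<2k (s≤s (s≤s {n = j} z≤n)) = ≡⇒≤ j (eq j)
  where
  eq : ∀ j → suc (suc (suc j) + 1) + j ≡ 2 * suc (suc j)
  eq = solve-∀

data Kind : Set where
  low mid high : Kind

-- Discharging weights, scaled by (k+1)(k+2) to stay integral: an edge at a vertex of degree k+1 gives
-- 2k/(k+1) to that end and 2/(k+1) to the other; an edge at a vertex of degree between k+2 and 2k-1 gives
-- 2k/(k+2) and 4/(k+2); any other edge gives 1 and 1.  A class thereby has enough once it receives 2k.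
module _ (k : ℕ) where

  unit : ℕ
  unit = 2 * ((k + 1) * (k + 2))

  φ : Kind → Kind → ℕ
  φ low  high = 2 * k * (k + 2)
  φ high low  = 2 * (k + 2)
  φ mid  high = 2 * k * (k + 1)
  φ high mid  = 4 * (k + 1)
  φ _    _    = (k + 1) * (k + 2)

  kindOf : ∀ {d} → Dec (d ≡ k + 1) → Dec (d < 2 * k) → Kind
  kindOf (yes _) _       = low
  kindOf (no _)  (yes _) = mid
  kindOf (no _)  (no _)  = high

  kind : ℕ → Kind
  kind d = kindOf (d ≟ k + 1) (d <? 2 * k)

  data View (d : ℕ) : Kind → Set where
    low  : d ≡ k + 1 → View d low
    mid  : k + 2 ≤ d → d < 2 * k → View d mid
    high : 2 * k ≤ d → View d high

  view : ∀ d → k + 1 ≤ d → View d (kind d)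
  view d k+1≤d = by-cases (d ≟ k + 1) (d <? 2 * k)
    where
    by-cases : (p? : Dec (d ≡ k + 1)) (q? : Dec (d < 2 * k)) → View d (kindOf p? q?)
    by-cases (yes eq) _        = low eq
    by-cases (no neq) (yes lt) = mid (≤-trans (≤-reflexive (+-suc k 1)) (≤∧≢⇒< k+1≤d (neq ∘ sym))) lt
    by-cases (no _)   (no ≮)   = high (≮⇒≥ ≮)

  φ-sum : ∀ c c′ → φ c c′ + φ c′ c ≡ unit
  φ-sum low  low  = eq k where
    eq : ∀ k → (k + 1) * (k + 2) + (k + 1) * (k + 2) ≡ 2 * ((k + 1) * (k + 2))
    eq = solve-∀
  φ-sum low  mid  = φ-sum low low
  φ-sum low  high = eq k where
    eq : ∀ k → 2 * k * (k + 2) + 2 * (k + 2) ≡ 2 * ((k + 1) * (k + 2))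
    eq = solve-∀
  φ-sum mid  low  = φ-sum low low
  φ-sum mid  mid  = φ-sum low low
  φ-sum mid  high = eq k where
    eq : ∀ k → 2 * k * (k + 1) + 4 * (k + 1) ≡ 2 * ((k + 1) * (k + 2))
    eq = solve-∀
  φ-sum high low  = trans (+-comm (φ high low) (φ low high)) (φ-sum low high)
  φ-sum high mid  = trans (+-comm (φ high mid) (φ mid high)) (φ-sum mid high)
  φ-sum high high = φ-sum low low

  4[k+1]≤[k+1][k+2] : 2 ≤ k → 4 * (k + 1) ≤ (k + 1) * (k + 2)
  4[k+1]≤[k+1][k+2] 2≤k = ≤-trans (*-monoˡ-≤ (k + 1) (+-monoˡ-≤ 2 2≤k)) (≤-reflexive (*-comm (k + 2) (k + 1)))

  2[k+2]≤4[k+1] : 2 * (k + 2) ≤ 4 * (k + 1)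
  2[k+2]≤4[k+1] = ≡⇒≤ (2 * k) (eq k)
    where
    eq : ∀ k → 2 * (k + 2) + 2 * k ≡ 4 * (k + 1)
    eq = solve-∀

  -- The smallest share is 2/(k+1) before scaling, that of a high end beside a low one. A class with
  -- k²+k leaving edges thus always receives its 2k.
  φ-≥ : 2 ≤ k → ∀ c c′ → 2 * (k + 2) ≤ φ c c′
  φ-≥ 2≤k low  low  = ≤-trans 2[k+2]≤4[k+1] (4[k+1]≤[k+1][k+2] 2≤k)
  φ-≥ 2≤k low  mid  = φ-≥ 2≤k low low
  φ-≥ 2≤k low  high = *-monoˡ-≤ (k + 2) (*-monoʳ-≤ 2 (<⇒≤ 2≤k))
  φ-≥ 2≤k mid  low  = φ-≥ 2≤k low low
  φ-≥ 2≤k mid  mid  = φ-≥ 2≤k low low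
  φ-≥ 2≤k mid  high = ≤-trans 2[k+2]≤4[k+1] (*-monoˡ-≤ (k + 1) (*-monoʳ-≤ 2 2≤k))
  φ-≥ 2≤k high low  = ≤-refl
  φ-≥ 2≤k high mid  = 2[k+2]≤4[k+1]
  φ-≥ 2≤k high high = φ-≥ 2≤k low low

-- The partition inequality

module Packability (G : SimpleGraph n) (k : ℕ) (2≤k : 2 ≤ k) (m : ℕ) (m+1≡ : m + 1 ≡ k * k + 2 * k)
                   (conn : KConnected (LineGraph G) m) (δ : MinDegree≥ G (k + 1)) where
  open LineGraphEdges G
  open Connectivity m conn
  open Charging G

  private
    κ : Fin n → Kind
    κ x = kind k (degree G x)

  degrees-≥ : ∀ {x y} → adj G x y ≡ true → k * k + 2 * k + 1 ≤ degree G x + degree G y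
  degrees-≥ xy = ≤-trans (≤-reflexive (trans (cong (_+ 1) (sym m+1≡)) (+-assoc m 1 1))) (degree-sum xy)

  degree-≥-beside-small : ∀ {x y} → adj G x y ≡ true → degree G x < 2 * k → k * k + 2 ≤ degree G y
  degree-≥-beside-small {x} {y} xy lt = +-cancelˡ-≤ (2 * k) _ _ (begin
    2 * k + (k * k + 2)               ≡⟨ eq k ⟩
    suc (k * k + 2 * k + 1)           ≤⟨ s≤s (degrees-≥ xy) ⟩
    suc (degree G x) + degree G y     ≤⟨ +-monoˡ-≤ (degree G y) lt ⟩
    2 * k + degree G y                ∎)
    where
    open ≤-Reasoning
    eq : ∀ k → 2 * k + (k * k + 2) ≡ suc (k * k + 2 * k + 1)
    eq = solve-∀

  -- Such a neighbour has degree at least k²+2, which exceeds k+1 and is at least 2k.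
  high-beside-small : ∀ {x y} → adj G x y ≡ true → degree G x < 2 * k → κ y ≡ high
  high-beside-small {x} {y} xy lt with κ y | view k (degree G y) (δ y)
  ... | low  | low eq   = contradiction (subst (k * k + 2 ≤_) eq (degree-≥-beside-small xy lt)) (<⇒≱ (k+1<k²+2 2≤k))
  ... | mid  | mid _ lt′ = contradiction (≤-trans (2k≤k²+2 2≤k) (degree-≥-beside-small xy lt)) (<⇒≱ lt′)
  ... | high | high _   = refl

  degree-≥-beside-low : ∀ {x y} → adj G x y ≡ true → degree G y ≡ k + 1 → k * k + k ≤ degree G x
  degree-≥-beside-low {x} {y} xy eq = +-cancelʳ-≤ (k + 1) _ _ (begin
    k * k + k + (k + 1)     ≡⟨ regroup k ⟩
    k * k + 2 * k + 1       ≤⟨ degrees-≥ xy ⟩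
    degree G x + degree G y ≡⟨ cong (degree G x +_) eq ⟩
    degree G x + (k + 1)    ∎)
    where
    open ≤-Reasoning
    regroup : ∀ k → k * k + k + (k + 1) ≡ k * k + 2 * k + 1
    regroup = solve-∀

  row-≥ : ∀ x {f : Fin n → ℕ} {q d} → (∀ y → adj G x y ≡ true → q ≤ f y) → d ≤ degree G x →
          d * q ≤ ∑ (allFin n) (λ y → weight x y * f y)
  row-≥ x {f} {q} {d} q≤f d≤ = begin
    d * q                                  ≤⟨ *-monoˡ-≤ q d≤ ⟩
    degree G x * q                         ≡⟨ ∑-*ʳ (allFin n) (weight x) q ⟨
    ∑ (allFin n) (λ y → weight x y * q)    ≤⟨ ∑-mono (allFin n) pointwise ⟩
    ∑ (allFin n) (λ y → weight x y * f y)  ∎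
    where
    open ≤-Reasoning
    pointwise : ∀ y → weight x y * q ≤ weight x y * f y
    pointwise y with adj G x y in xy
    ... | true  = +-monoˡ-≤ 0 (q≤f y xy)
    ... | false = z≤n

  -- Before scaling the target is 2k. A low vertex has k+1 edges with 2k/(k+1) each, a mid one at
  -- least k+2 edges with 2k/(k+2) each. A high vertex beside a low one has at least k²+k edges with
  -- at least 2/(k+1) each; failing that, beside a mid one, at least k²+2 edges with at least
  -- 4/(k+2) each; and otherwise at least 2k edges with 1 each.
  vertex-enough : ∀ x {c} → View k (degree G x) c →
                  k * unit k ≤ ∑ (allFin n) (λ y → weight x y * φ k c (κ y))
  vertex-enough x (low eq) = ≤-trans (≤-reflexive (calc k)) (row-≥ x
    (λ y xy → ≤-reflexive (sym (cong (φ k low) (high-beside-small xy (subst (_< 2 * k) (sym eq) (k+1<2k 2≤k))))))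
    (≤-reflexive (sym eq)))
    where
    calc : ∀ k → k * (2 * ((k + 1) * (k + 2))) ≡ (k + 1) * (2 * k * (k + 2))
    calc = solve-∀
  vertex-enough x (mid k+2≤d d<2k) = ≤-trans (≤-reflexive (calc k)) (row-≥ x
    (λ y xy → ≤-reflexive (sym (cong (φ k mid) (high-beside-small xy d<2k)))) k+2≤d)
    where
    calc : ∀ k → k * (2 * ((k + 1) * (k + 2))) ≡ (k + 2) * (2 * k * (k + 1))
    calc = solve-∀
  vertex-enough x (high 2k≤d) with F.any? (λ y → (adj G x y Bool.≟ true) ×-dec (degree G y ≟ k + 1))
  ... | yes (y , xy , eq) = ≤-trans (≤-reflexive (calc k))
          (row-≥ x (λ z _ → φ-≥ k 2≤k high (κ z)) (degree-≥-beside-low xy eq))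
    where
    calc : ∀ k → k * (2 * ((k + 1) * (k + 2))) ≡ (k * k + k) * (2 * (k + 2))
    calc = solve-∀
  ... | no ¬low with F.any? (λ y → (adj G x y Bool.≟ true) ×-dec (degree G y <? 2 * k))
  ...   | yes (y , xy , d<2k) = ≤-trans (calc 2≤k)
            (row-≥ x bound (degree-≥-beside-small (trans (adj-sym G y x) xy) d<2k))
    where
    calc : ∀ {k} → 2 ≤ k → k * (2 * ((k + 1) * (k + 2))) ≤ (k * k + 2) * (4 * (k + 1))
    calc (s≤s (s≤s {n = j} z≤n)) = ≡⇒≤ _ (eq j)
      where
      -- The difference is 2(k+1)(k²-2k+4), written in j = k-2.
      eq : ∀ j → suc (suc j) * (2 * ((suc (suc j) + 1) * (suc (suc j) + 2))) +
                 2 * (suc (suc j) + 1) * (j * j + 2 * j + 4) ≡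
                 (suc (suc j) * suc (suc j) + 2) * (4 * (suc (suc j) + 1))
      eq = solve-∀
    bound : ∀ z → adj G x z ≡ true → 4 * (k + 1) ≤ φ k high (κ z)
    bound z xz with κ z | view k (degree G z) (δ z)
    ... | low  | low eq  = contradiction (z , xz , eq) ¬low
    ... | mid  | mid _ _ = ≤-refl
    ... | high | high _  = 4[k+1]≤[k+1][k+2] k 2≤k
  ...   | no ¬small = ≤-trans (≤-reflexive (calc k)) (row-≥ x bound 2k≤d)
    where
    calc : ∀ k → k * (2 * ((k + 1) * (k + 2))) ≡ 2 * k * ((k + 1) * (k + 2))
    calc = solve-∀
    bound : ∀ z → adj G x z ≡ true → (k + 1) * (k + 2) ≤ φ k high (κ z)
    bound z xz with κ z | view k (degree G z) (δ z)
    ... | low  | low eq   = contradiction (z , xz , eq) ¬low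
    ... | mid  | mid _ lt = contradiction (z , xz , lt) ¬small
    ... | high | high _   = ≤-refl

  module _ (l : Fin n → Fin n) where

    -- This reduces a class with no edge inside to its label: all edges at `t` then leave the class,
    -- so whatever they pay at `t` goes to the class.
    row-≤-classCharge : ∀ ψ t → l t ≡ t → (∀ y → adj G t y ≡ true → l y ≢ t) →
                        ∑ (allFin n) (λ y → weight t y * ψ t y) ≤ classCharge l ψ t
    row-≤-classCharge ψ t fixed outward = begin
      ∑ (allFin n) (λ y → weight t y * ψ t y)
        ≤⟨ ∑-mono (allFin n) pointwise ⟩
      ∑ (allFin n) (λ y → ⟦ ¬? (l y F.≟ t) ⟧ * (weight t y * ψ t y))
        ≡⟨ +-identityʳ _ ⟨
      1 * ∑ (allFin n) (λ y → ⟦ ¬? (l y F.≟ t) ⟧ * (weight t y * ψ t y))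
        ≡⟨ cong (_* ∑ (allFin n) (λ y → ⟦ ¬? (l y F.≟ t) ⟧ * (weight t y * ψ t y))) (⟦⟧-true (l t F.≟ t) fixed) ⟨
      ⟦ l t F.≟ t ⟧ * ∑ (allFin n) (λ y → ⟦ ¬? (l y F.≟ t) ⟧ * (weight t y * ψ t y))
        ≤⟨ ∑-term (λ x → ⟦ l x F.≟ t ⟧ * ∑ (allFin n) (λ y → ⟦ ¬? (l y F.≟ t) ⟧ * (weight x y * ψ x y))) (∈-allFin t) ⟩
      classCharge l ψ t ∎
      where
      open ≤-Reasoning
      pointwise : ∀ y → weight t y * ψ t y ≤ ⟦ ¬? (l y F.≟ t) ⟧ * (weight t y * ψ t y)
      pointwise y with adj G t y in ty
      ... | false = z≤n
      ... | true  rewrite ⟦⟧-true (¬? (l y F.≟ t)) (outward y ty) = m≤m+n _ 0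

    boundarySize-≤-classCharge : ∀ ψ q t → (∀ x y → q ≤ ψ x y) →
                                 boundarySize (λ x → l x F.≟ t) * q ≤ classCharge l ψ t
    boundarySize-≤-classCharge ψ q t q≤ψ = begin
      boundarySize (λ x → l x F.≟ t) * q
        ≡⟨ ∑-*ʳ (allFin n) _ q ⟨
      ∑ (allFin n) (λ x → ⟦ l x F.≟ t ⟧ * ∑ (allFin n) (λ y → ⟦ ¬? (l y F.≟ t) ⟧ * weight x y) * q)
        ≤⟨ ∑-mono (allFin n) (λ x → ≤-trans (≤-reflexive (*-assoc ⟦ l x F.≟ t ⟧ _ q)) (*-monoʳ-≤ ⟦ l x F.≟ t ⟧ (inner x))) ⟩
      classCharge l ψ t ∎
      where
      open ≤-Reasoning
      inner : ∀ x → ∑ (allFin n) (λ y → ⟦ ¬? (l y F.≟ t) ⟧ * weight x y) * q ≤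
                    ∑ (allFin n) (λ y → ⟦ ¬? (l y F.≟ t) ⟧ * (weight x y * ψ x y))
      inner x = ≤-trans (≤-reflexive (sym (∑-*ʳ (allFin n) _ q))) (∑-mono (allFin n) λ y →
        ≤-trans (≤-reflexive (*-assoc ⟦ ¬? (l y F.≟ t) ⟧ (weight x y) q))
                (*-monoʳ-≤ ⟦ ¬? (l y F.≟ t) ⟧ (*-monoʳ-≤ (weight x y) (q≤ψ x y))))

    Internal External : Fin n → Set
    Internal t = ∃ λ x → ∃ λ y → adj G x y ≡ true × l x ≡ t × l y ≡ t
    External t = ∃ λ x → ∃ λ y → adj G x y ≡ true × l x ≢ t × l y ≢ t

    internal? : ∀ t → Dec (Internal t)
    internal? t = F.any? λ x → F.any? λ y → (adj G x y Bool.≟ true) ×-dec (l x F.≟ t) ×-dec (l y F.≟ t)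

    external? : ∀ t → Dec (External t)
    external? t = F.any? λ x → F.any? λ y → (adj G x y Bool.≟ true) ×-dec ¬? (l x F.≟ t) ×-dec ¬? (l y F.≟ t)

    private
      outward : ∀ {t} → l t ≡ t → ¬ Internal t → ∀ y → adj G t y ≡ true → l y ≢ t
      outward {t} fixed ¬int y ty ly≡t = ¬int (t , y , ty , fixed , ly≡t)

    -- Here every class receives enough. If it has an edge inside, `spread` supplies one outside, so
    -- connectivity yields at least m ≥ k²+k leaving edges with at least 2/(k+1) each. If it has
    -- none, its label vertex alone collects 2k.
    charged-generic : Fin n → (∀ t → External t) →
      ∑ (allFin n) (λ t → ⟦ l t F.≟ t ⟧) * (k * unit k) ≤ unit k * crossings l + k * unit k
    charged-generic t₀ spread = charging l ψ (unit k) (λ x y _ _ → ≤-reflexive (φ-sum k (κ x) (κ y)))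
      (k * unit k) t₀ (λ t fixed → ≤-trans (enough t fixed) (m≤m+n _ _))
      where
      ψ : Fin n → Fin n → ℕ
      ψ x y = φ k (κ x) (κ y)
      k²+k≤m : k * k + k ≤ m
      k²+k≤m = +-cancelʳ-≤ 1 _ _ (begin
        k * k + k + 1   ≤⟨ +-monoʳ-≤ (k * k + k) (<⇒≤ 2≤k) ⟩
        k * k + k + k   ≡⟨ regroup k ⟩
        k * k + 2 * k   ≡⟨ m+1≡ ⟨
        m + 1           ∎)
        where
        open ≤-Reasoning
        regroup : ∀ k → k * k + k + k ≡ k * k + 2 * k
        regroup = solve-∀
      calc : ∀ k → k * (2 * ((k + 1) * (k + 2))) ≡ (k * k + k) * (2 * (k + 2))
      calc = solve-∀
      enough : ∀ t → l t ≡ t → k * unit k ≤ classCharge l ψ t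
      enough t fixed with internal? t
      ... | no ¬int = ≤-trans (vertex-enough t (view k (degree G t) (δ t)))
                              (row-≤-classCharge ψ t fixed (outward fixed ¬int))
      ... | yes (x , y , xy , lx , ly) with spread t
      ...   | u , v , uv , lu , lv = begin
        k * unit k                                         ≡⟨ calc k ⟩
        (k * k + k) * (2 * (k + 2))                        ≤⟨ *-monoˡ-≤ (2 * (k + 2)) (≤-trans k²+k≤m (boundary-≥ (λ z → l z F.≟ t) xy lx ly uv lu lv)) ⟩
        boundarySize (λ z → l z F.≟ t) * (2 * (k + 2))     ≤⟨ boundarySize-≤-classCharge ψ _ t (λ x y → φ-≥ k 2≤k (κ x) (κ y)) ⟩
        classCharge l ψ t                                  ∎
        where open ≤-Reasoning

    -- Every edge meets the class of `t₀`. A crossing edge therefore joins that class to another one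
    -- and pays its whole charge to the other. The other classes have no edge inside, and the label
    -- of each has at least `k` edges, all paying `unit k`. The class of `t₀` is the exempt one.
    charged-exceptional : ∀ t₀ → ¬ External t₀ →
      ∑ (allFin n) (λ t → ⟦ l t F.≟ t ⟧) * (k * unit k) ≤ unit k * crossings l + k * unit k
    charged-exceptional t₀ ¬ext = charging l ψ (unit k) ψ-≤ (k * unit k) t₀ enough
      where
      ψ : Fin n → Fin n → ℕ
      ψ x y = ⟦ ¬? (l x F.≟ t₀) ⟧ * unit k
      ψ-≤ : ∀ x y → adj G x y ≡ true → l x ≢ l y → ψ x y + ψ y x ≤ unit k
      ψ-≤ x y xy neq with l x F.≟ t₀ | l y F.≟ t₀
      ... | yes p | yes q = contradiction (trans p (sym q)) neq
      ... | yes _ | no _  = ≤-reflexive (+-identityʳ _)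
      ... | no _  | yes _ = ≤-reflexive (trans (+-identityʳ _) (+-identityʳ _))
      ... | no p  | no q  = contradiction (x , y , xy , p , q) ¬ext
      enough : ∀ t → l t ≡ t → k * unit k ≤ classCharge l ψ t + ⟦ t F.≟ t₀ ⟧ * (k * unit k)
      enough t fixed with t F.≟ t₀
      ... | yes _   = ≤-trans (m≤m+n _ 0) (m≤n+m _ (classCharge l ψ t))
      ... | no t≢t₀ = ≤-trans (≤-trans (row-≥ t full (≤-trans (m≤m+n k 1) (δ t)))
                                       (row-≤-classCharge ψ t fixed outside)) (m≤m+n _ _)
        where
        full : ∀ y → adj G t y ≡ true → unit k ≤ ψ t y
        full y _ rewrite ⟦⟧-true (¬? (l t F.≟ t₀)) (λ eq → t≢t₀ (trans (sym fixed) eq)) = m≤m+n _ 0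
        outside : ∀ y → adj G t y ≡ true → l y ≢ t
        outside y ty ly≡t = ¬ext (t , y , ty , (λ eq → t≢t₀ (trans (sym fixed) eq)) , (λ eq → t≢t₀ (trans (sym ly≡t) eq)))

    -- The Nash-Williams-Tutte inequality for the partition given by `l`, after cancelling the scale
    -- `unit k`. The case split is on whether the edges all meet a single class.
    partition-bound : Fin n → k * ∑ (allFin n) (λ t → ⟦ l t F.≟ t ⟧) ≤ crossings l + k
    partition-bound v = *-cancelˡ-≤ (unit k) {{nz}} (begin
      unit k * (k * c)                      ≡⟨ rearrange (unit k) k c ⟩
      c * (k * unit k)                      ≤⟨ charged ⟩
      unit k * crossings l + k * unit k     ≡⟨ factor (unit k) (crossings l) k ⟩
      unit k * (crossings l + k)            ∎)
      where
      open ≤-Reasoning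
      c : ℕ
      c = ∑ (allFin n) (λ t → ⟦ l t F.≟ t ⟧)
      rearrange : ∀ a b c → a * (b * c) ≡ c * (b * a)
      rearrange = solve-∀
      factor : ∀ a b c → a * b + c * a ≡ a * (b + c)
      factor = solve-∀
      nz : NonZero (unit k)
      nz = >-nonZero (*-mono-≤ {1} {2} (s≤s z≤n) (*-mono-≤ (m≤n+m 1 k) (≤-trans (s≤s z≤n) (m≤n+m 2 k))))
      charged : c * (k * unit k) ≤ unit k * crossings l + k * unit k
      charged with F.any? (λ t → ¬? (external? t))
      ... | yes (t , ¬ext) = charged-exceptional t ¬ext
      ... | no  all-ext    = charged-generic v λ t → decidable-stable (external? t) (λ ¬ext → all-ext (t , ¬ext))

  -- The components of the selected edges form a partition that no selected edge crosses, so the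
  -- crossing edges promised by `partition-bound` are all among the unselected ones.
  packable : Fin n → Packable {k = k} edgePairs (λ _ → [])
  packable v M = begin
    ∑ (allFin k) (λ _ → components (L ++ [])) + length L
      ≡⟨ cong (λ L′ → ∑ (allFin k) (λ _ → components L′) + length L) (++-identityʳ L) ⟩
    ∑ (allFin k) (λ _ → components L) + length L
      ≡⟨ cong (_+ length L) const ⟩
    k * components L + length L
      ≤⟨ +-monoˡ-≤ (length L) (partition-bound (lab L) v) ⟩
    crossings (lab L) + k + length L
      ≡⟨ rotate (crossings (lab L)) k (length L) ⟩
    length L + crossings (lab L) + k
      ≤⟨ +-monoˡ-≤ k (length-select-≤ (crossing? (lab L)) edgePairs M (λ e∈ neq → neq (Joined-∈ L e∈))) ⟩
    length edgePairs + k ∎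
    where
    open ≤-Reasoning
    L : List (Fin n × Fin n)
    L = select edgePairs M
    const : ∑ (allFin k) (λ _ → components L) ≡ k * components L
    const = trans (∑-cong (allFin k) (λ _ → sym (+-identityʳ (components L))))
              (trans (∑-*ʳ (allFin k) (λ _ → 1) (components L))
                (cong (_* components L) (trans (∑-one (allFin k)) (length-tabulate {n = k} id))))
    rotate : ∀ a b c → a + b + c ≡ c + a + b
    rotate = solve-∀

-- Rooted trees

-- The root has no parent; up sends it to an arbitrary neighbour instead, so that every vertex x
-- has an edge to up x.
record RootedTree (E : Fin n → Fin n → Set) (r : Fin n) : Set where
  field
    up      : Fin n → Fin n
    height  : Fin n → ℕ
    up-edge : ∀ x → E x (up x)
    up-<    : ∀ {x} → x ≢ r → height (up x) < height x

module BreadthFirst {E : Fin n → Fin n → Set} (E? : ∀ x y → Dec (E x y))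
                    (E-sym : ∀ {x y} → E x y → E y x) (r : Fin n) where

  Within : ℕ → Fin n → Set
  Within zero    x = x ≡ r
  Within (suc d) x = Within d x ⊎ ∃ λ y → E x y × Within d y

  within? : ∀ d x → Dec (Within d x)
  within? zero    x = x F.≟ r
  within? (suc d) x = within? d x ⊎-dec F.any? λ y → E? x y ×-dec within? d y

  Within-mono : ∀ {c d x} → c ≤ d → Within c x → Within d x
  Within-mono {d = zero}  z≤n w = w
  Within-mono {d = suc d} c≤d w with m≤n⇒m<n∨m≡n c≤d
  ... | inj₁ c<d  = inj₁ (Within-mono (s≤s⁻¹ c<d) w)
  ... | inj₂ refl = w

  data Distance (x : Fin n) : ℕ → Set where
    root : x ≡ r → Distance x 0
    step : ∀ {d y} → ¬ Within d x → E x y → Within d y → Distance x (suc d)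

  distance : ∀ d x → Within d x → ∃ (Distance x)
  distance zero    x x≡r = 0 , root x≡r
  distance (suc d) x w with within? d x
  distance (suc d) x w                      | yes w′ = distance d x w′
  distance (suc d) x (inj₁ w)               | no ¬w  = contradiction w ¬w
  distance (suc d) x (inj₂ (y , xy , w))    | no ¬w  = suc d , step ¬w xy w

  Distance-≤ : ∀ {x c d} → Distance x d → Within c x → d ≤ c
  Distance-≤ (root _)      _ = z≤n
  Distance-≤ (step ¬w _ _) w = ≰⇒> λ c≤d → ¬w (Within-mono c≤d w)

  Reachable : Fin n → Set
  Reachable x = ∃ λ d → Within d x

  -- `Joined-least` is applied to the equivalence of `u` and `v` that says that each is reachable if
  -- the other is. Edges respect it, and the root is reachable.
  reachable : (L : List (Fin n × Fin n)) → (∀ {a b} → (a , b) ∈ L → E a b) → ∀ x → Joined L x r → Reachable x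
  reachable L L⊆E x joined = proj₂ (Joined-least equivalence L (λ ab∈ → along (L⊆E ab∈) , along (E-sym (L⊆E ab∈))) joined) (0 , refl)
    where
    equivalence : IsEquivalence λ u v → (Reachable u → Reachable v) × (Reachable v → Reachable u)
    equivalence = record
      { refl  = id , id
      ; sym   = λ (f , g) → g , f
      ; trans = λ (f , g) (f′ , g′) → f′ ∘ f , g ∘ g′ }
    along : ∀ {a b} → E a b → Reachable a → Reachable b
    along ab (d , w) = suc d , inj₂ (_ , E-sym ab , w)

  rootedTree : (∀ x → Reachable x) → ∀ s → s ≢ r → RootedTree E r
  rootedTree reach s s≢r = record
    { up      = up
    ; height  = height
    ; up-edge = up-edge
    ; up-<    = up-< }
    where
    dist : ∀ x → ∃ (Distance x)
    dist x = distance (proj₁ (reach x)) x (proj₂ (reach x))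

    height : Fin n → ℕ
    height x = proj₁ (dist x)

    parent : ∀ x → x ≢ r → ∃ λ y → E x y × height y < height x
    parent x x≢r with dist x
    ... | 0     , root x≡r             = contradiction x≡r x≢r
    ... | suc d , step {y = y} _ xy w  = y , xy , s≤s (Distance-≤ (proj₂ (dist y)) w)

    par : Fin n → Fin n
    par x with x F.≟ r
    ... | yes _   = r
    ... | no x≢r  = proj₁ (parent x x≢r)

    par-spec : ∀ x → x ≢ r → E x (par x) × height (par x) < height x
    par-spec x x≢r with x F.≟ r
    ... | yes x≡r  = contradiction x≡r x≢r
    ... | no x≢r′  = proj₂ (parent x x≢r′)

    -- Parents are followed from `x` until the next one is the root; the vertex reached is then a
    -- neighbour of the root. The bound `d` on the height makes the recursion structural.
    neighbour : ∀ d x → height x ≤ d → x ≢ r → ∃ (E r)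
    neighbour zero    x h≤0 x≢r with () ← ≤-trans (proj₂ (par-spec x x≢r)) h≤0
    neighbour (suc d) x h≤d x≢r with par x F.≟ r
    ... | yes eq = x , E-sym (subst (E x) eq (proj₁ (par-spec x x≢r)))
    ... | no neq = neighbour d (par x) (s≤s⁻¹ (≤-trans (proj₂ (par-spec x x≢r)) h≤d)) neq

    beside-root : ∃ (E r)
    beside-root = neighbour (height s) s ≤-refl s≢r

    up : Fin n → Fin n
    up x = if does (x F.≟ r) then proj₁ beside-root else par x

    up-root : up r ≡ proj₁ beside-root
    up-root with r F.≟ r
    ... | yes _  = refl
    ... | no r≢r = contradiction refl r≢r

    up-par : ∀ {x} → x ≢ r → up x ≡ par x
    up-par {x} x≢r with x F.≟ r
    ... | yes x≡r = contradiction x≡r x≢r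
    ... | no _    = refl

    up-edge : ∀ x → E x (up x)
    up-edge x = by-case (x F.≟ r)
      where
      by-case : Dec (x ≡ r) → E x (up x)
      by-case (no x≢r)   = subst (E x) (sym (up-par x≢r)) (proj₁ (par-spec x x≢r))
      by-case (yes refl) = subst (E r) (sym up-root) (proj₂ beside-root)

    up-< : ∀ {x} → x ≢ r → height (up x) < height x
    up-< x≢r rewrite up-par x≢r = proj₂ (par-spec _ x≢r)

-- Trees given by a parent map

module ParentTree {V : Set} (parent : V → V) (root : V) (root? : ∀ u → Dec (u ≡ root)) (height : V → ℕ)
                  (parent-< : ∀ {u} → u ≢ root → height (parent u) < height u) where

  Tree : V → V → Set
  Tree u v = (u ≢ root × parent u ≡ v) ⊎ (v ≢ root × parent v ≡ u)

  Tree-sym : ∀ {u v} → Tree u v → Tree v u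
  Tree-sym (inj₁ p) = inj₂ p
  Tree-sym (inj₂ p) = inj₁ p

  private
    _◅◅_ : ∀ {u v w} → Walk Tree u v → Walk Tree v w → Walk Tree u w
    []      ◅◅ q = q
    (e ∷ p) ◅◅ q = e ∷ (p ◅◅ q)

    reverse : ∀ {u v} → Walk Tree u v → Walk Tree v u
    reverse []      = []
    reverse (e ∷ p) = reverse p ◅◅ (Tree-sym e ∷ [])

    to-root : ∀ d u → height u ≤ d → Walk Tree u root
    to-root d u h≤d with root? u
    ... | yes refl = []
    to-root zero    u h≤d | no u≢ with () ← ≤-trans (parent-< u≢) h≤d
    to-root (suc d) u h≤d | no u≢ =
      inj₁ (u≢ , refl) ∷ to-root d (parent u) (s≤s⁻¹ (≤-trans (parent-< u≢) h≤d))

    first∈ : ∀ {u v} (p : Walk Tree u v) → u ∈ verts p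
    first∈ []      = here refl
    first∈ (_ ∷ _) = here refl

    last∈ : ∀ {u v} (p : Walk Tree u v) → v ∈ verts p
    last∈ []      = here refl
    last∈ (_ ∷ p) = there (last∈ p)

    -- A path that has once stepped from a parent to a child keeps descending.
    descend : ∀ {u x w} (e : Tree u x) (p : Walk Tree x w) → IsPath (e ∷ p) → x ≢ root → parent x ≡ u →
              parent w ∈ verts (e ∷ p) × height u < height w
    descend e [] path x≢ refl = here refl , parent-< x≢
    descend e (e′ ∷ p) (u∉ ∷ path) x≢ refl with e′
    ... | inj₁ (_ , eq)    = contradiction eq (All.lookup u∉ (there (first∈ p)))
    ... | inj₂ (y≢ , refl) with descend e′ p path y≢ refl
    ...   | ∈p , lt = there ∈p , <-trans (parent-< x≢) lt

    -- A path either climbs all the way or turns downwards somewhere, and from there on `descend`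
    -- applies.
    climb : ∀ {u w} (p : Walk Tree u w) → IsPath p → height w ≤ height u ⊎ parent w ∈ verts p
    climb []      _    = inj₁ ≤-refl
    climb (e ∷ p) path@(_ ∷ path′) with e
    ... | inj₂ (x≢ , eq)  = inj₂ (proj₁ (descend e p path x≢ eq))
    ... | inj₁ (u≢ , refl) with climb p path′
    ...   | inj₁ le = inj₁ (≤-trans le (<⇒≤ (parent-< u≢)))
    ...   | inj₂ ∈p = inj₂ (there ∈p)

  connected : ∀ u v → Walk Tree u v
  connected u v = to-root _ u ≤-refl ◅◅ reverse (to-root _ v ≤-refl)

  -- Four cases, by whether the first edge and the closing edge lead from `u` to its parent. Both:
  -- the second and the last vertex coincide. Only the first: by `climb`, the heights decrease in a
  -- circle or the path returns to `u`. Only the closing one: the path descends from `u` to the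
  -- parent of `u`. Neither: the path keeps descending and passes through the parent of `w`, which
  -- is `u` again.
  acyclic : ∀ {u w} (p : Walk Tree u w) → IsPath p → 2 ≤ walkLength p → ¬ Tree w u
  acyclic (e ∷ [])            path             (s≤s ()) wu
  acyclic (e ∷ (e′ ∷ p)) path@(u∉ ∷ path′@(x∉ ∷ _)) _ wu with e | wu
  ... | inj₁ (_ , refl) | inj₂ (_ , eq)  = All.lookup x∉ (last∈ p) eq
  ... | inj₁ (u≢ , refl) | inj₁ (w≢ , refl) with climb (e′ ∷ p) path′
  ...   | inj₁ le = <⇒≱ (<-trans (parent-< u≢) (parent-< w≢)) le
  ...   | inj₂ ∈p = All.lookup u∉ ∈p refl
  acyclic (e ∷ (e′ ∷ p)) path@(u∉ ∷ x∉ ∷ _) _ wu | inj₂ (x≢ , refl) | inj₂ (u≢ , refl) =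
    <⇒≱ (parent-< u≢) (<⇒≤ (proj₂ (descend e (e′ ∷ p) path x≢ refl)))
  acyclic (e ∷ (e′ ∷ p)) path@(u∉ ∷ path′) _ wu | inj₂ (x≢ , refl) | inj₁ (w≢ , eq) with e′
  ... | inj₁ (_ , eq′)   = All.lookup u∉ (there (first∈ p)) eq′
  ... | inj₂ (y≢ , refl) = All.lookup u∉ (proj₁ (descend e′ p path′ y≢ refl)) (sym eq)

  -- Were an inner vertex the parent of neither of its neighbours on the path, both would be its own
  -- parent and hence equal.
  interior-is-parent : ∀ {u v x} (p : Walk Tree u v) → IsPath p → x ∈ verts p → x ≢ u → x ≢ v → ∃ λ y → parent y ≡ x
  interior-is-parent []      _ (here refl) x≢u _ = contradiction refl x≢u
  interior-is-parent (e ∷ p) _ (here refl) x≢u _ = contradiction refl x≢u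
  interior-is-parent {x = x} (e ∷ p) path (there x∈) _ x≢v = go e p path x∈ x≢v
    where
    go : ∀ {u t v} (e : Tree u t) (p : Walk Tree t v) → IsPath (e ∷ p) → x ∈ verts p → x ≢ v → ∃ λ y → parent y ≡ x
    go e []       _          (here refl) x≢v = contradiction refl x≢v
    go e (e′ ∷ p) (_ ∷ path) (there x∈)  x≢v = go e′ p path x∈ x≢v
    go (inj₁ (_ , eq)) (e′ ∷ p) _ (here refl) _ = _ , eq
    go (inj₂ (_ , refl)) (inj₂ (_ , eq) ∷ p) _ (here refl) _ = _ , eq
    go (inj₂ (_ , refl)) (inj₁ (_ , eq) ∷ p) (u∉ ∷ _) (here refl) _ =
      contradiction eq (All.lookup u∉ (there (first∈ p)))

  used-edge : ∀ {a b u v} {p : Walk Tree u v} → UsesEdge a b p → Tree a b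
  used-edge (here-fwd e _) = e
  used-edge (here-bwd e _) = Tree-sym e
  used-edge (there _ h)    = used-edge h

-- From trees of the graph to trees of its line graph

module CompletelyIndependentTrees
  (G : SimpleGraph n) {E : Fin k → Fin n → Fin n → Set}
  (E-adj : ∀ {i x y} → E i x y → adj G x y ≡ true)
  (E-sym : ∀ {i x y} → E i x y → E i y x)
  (E-disjoint : ∀ {i j x y} → E i x y → E j x y → i ≡ j)
  (r : Fin k → Fin n) (r-injective : ∀ {i j} → r i ≡ r j → i ≡ j)
  (trees : ∀ i → RootedTree (E i) (r i)) where

  open LineGraphEdges G
  open module T i = RootedTree (trees i)

  private
    up-≢ : ∀ i {x} → x ≢ up i x
    up-≢ i {x} = adj⇒≢ (E-adj (up-edge i x))

    upEdge : Fin k → Fin n → Edge G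
    upEdge i x = edge x (up i x) (E-adj (up-edge i x))

    upEdge-endˡ : ∀ i x → EndpointOf {G = G} x (upEdge i x)
    upEdge-endˡ i x = edge-endˡ (E-adj (up-edge i x))

    upEdge-endʳ : ∀ i x → EndpointOf {G = G} (up i x) (upEdge i x)
    upEdge-endʳ i x = edge-endʳ (E-adj (up-edge i x))

    -- Both steps use one edge, so by disjointness the colours agree, and then the height would
    -- decrease in both directions.
    up-once : ∀ i j {a b} → a ≢ r i → up i a ≡ b → b ≢ r j → up j b ≡ a → ⊥
    up-once i j {a} a≢r refl b≢r eq with E-disjoint (up-edge i a) (E-sym (subst (E j (up i a)) eq (up-edge j (up i a))))
    ... | refl = <-asym (up-< i a≢r) (subst (λ z → height i z < height i (up i a)) eq (up-< i b≢r))

    points-up? : ∀ a b → Dec (∃ λ i → a ≢ r i × up i a ≡ b)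
    points-up? a b = F.any? λ i → ¬? (a F.≟ r i) ×-dec (up i a F.≟ b)

    -- One direction is tested: an edge whose `b` points up to `a` fails the test by `up-once` and
    -- gets its upper end `a` by default, as does an edge along which neither end points up.
    top : Edge G → Fin n
    top ((a , b) , _) = if does (points-up? a b) then b else a

    top-end : ∀ e → EndpointOf {G = G} (top e) e
    top-end ((a , b) , _) with does (points-up? a b)
    ... | true  = inj₂ refl
    ... | false = inj₁ refl

    top-up : ∀ i {x} → x ≢ r i → top (upEdge i x) ≡ up i x
    top-up i {x} x≢r = go (upEdge i x) (upEdge-endˡ i x) (upEdge-endʳ i x)
      where
      go : ∀ e → EndpointOf {G = G} x e → EndpointOf {G = G} (up i x) e → top e ≡ up i x
      go e (inj₁ refl) (inj₁ eq)   = contradiction (sym eq) (up-≢ i)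
      go e (inj₂ refl) (inj₂ eq)   = contradiction (sym eq) (up-≢ i)
      go ((a , b) , _) (inj₁ refl) (inj₂ refl) with points-up? a b
      ... | yes _ = refl
      ... | no ¬p = contradiction (i , x≢r , refl) ¬p
      go ((a , b) , _) (inj₂ refl) (inj₁ refl) with points-up? a b
      ... | yes (j , a≢r , eq) = ⊥-elim (up-once i j x≢r refl a≢r eq)
      ... | no _ = refl

    rootEdge : Fin k → Edge G
    rootEdge i = upEdge i (r i)

    -- Equal edges have the same ends, in one order or the other, and by symmetry of `E` the same
    -- pair then belongs to both colours.
    upEdge-disjoint : ∀ {i j} x y → upEdge i x ≡ upEdge j y → i ≡ j
    upEdge-disjoint {i} {j} x y eq
      with edge-ends (E-adj (up-edge j y)) (subst (EndpointOf {G = G} x) eq (upEdge-endˡ i x))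
         | edge-ends (E-adj (up-edge j y)) (subst (EndpointOf {G = G} (up i x)) eq (upEdge-endʳ i x))
    ... | inj₁ refl | inj₁ q    = contradiction (sym q) (up-≢ i)
    ... | inj₁ refl | inj₂ q    = E-disjoint (up-edge i x) (subst (E j x) (sym q) (up-edge j x))
    ... | inj₂ p    | inj₁ refl = E-disjoint (up-edge i x) (E-sym (subst (E j (up i x)) (sym p) (up-edge j (up i x))))
    ... | inj₂ p    | inj₂ q    = contradiction (trans p (sym q)) (up-≢ i)

    parent : Fin k → Edge G → Edge G
    parent i e = upEdge i (top e)

    -- Two edges e, f that are each other's parents, in different trees, would have a common top vertex x;
    -- x would then be the root of both trees.
    no-mutual-parents : ∀ {i j e f} → i ≢ j → parent i e ≡ f → parent j f ≡ e → ⊥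
    no-mutual-parents {i} {j} {e} {f} i≢j p q with top e F.≟ top f
    ... | no neq = i≢j (upEdge-disjoint (top e) (top f) (trans p (trans f≡e (sym q))))
      where
      f≡e : f ≡ e
      f≡e = ends-determine f e neq
        (subst (EndpointOf {G = G} (top e)) p (upEdge-endˡ i (top e))) (top-end f)
        (top-end e) (subst (EndpointOf {G = G} (top f)) q (upEdge-endˡ j (top f)))
    ... | yes eq = i≢j (r-injective (trans (sym (at-root i (trans (cong top p) (sym eq))))
                                      (trans eq (at-root j (trans (cong top q) eq)))))
      where
      at-root : ∀ i {x} → top (upEdge i x) ≡ x → x ≡ r i
      at-root i {x} fixed = decidable-stable (x F.≟ r i) λ x≢r → up-≢ i (trans (sym fixed) (top-up i x≢r))

    -- The successor lifts the edges with top `r i` above `rootEdge i`, their parent. Further up the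
    -- tree order, `top-up` says that passing to the parent moves the top from `x` to `up i x`.
    edgeHeight : Fin k → Edge G → ℕ
    edgeHeight i e = if does (e ≟ᵉ rootEdge i) then 0 else suc (height i (top e))

    parent-< : ∀ i {e} → e ≢ rootEdge i → edgeHeight i (parent i e) < edgeHeight i e
    parent-< i {e} e≢root with e ≟ᵉ rootEdge i
    ... | yes e≡root = contradiction e≡root e≢root
    ... | no _ with parent i e ≟ᵉ rootEdge i
    ...   | yes _     = s≤s z≤n
    ...   | no p≢root = s≤s (subst (λ t → height i t < height i (top e)) (sym (top-up i top≢r)) (up-< i top≢r))
      where
      top≢r : top e ≢ r i
      top≢r eq = p≢root (cong (upEdge i) eq)

    open module P i = ParentTree (parent i) (rootEdge i) (_≟ᵉ rootEdge i) (edgeHeight i) (parent-< i)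

    parent-adjacent : ∀ i {e} → e ≢ rootEdge i → LAdj G e (parent i e)
    parent-adjacent i {e} e≢root =
      (λ eq → <-irrefl (cong (edgeHeight i) (sym eq)) (parent-< i e≢root)) , top e , top-end e , upEdge-endˡ i (top e)

    spanningTree : ∀ i → SpanningTree (LineGraph G) (Tree i)
    spanningTree i = record
      { sub       = λ { (inj₁ (u≢ , refl)) → parent-adjacent i u≢
                      ; (inj₂ (v≢ , refl)) → Adj-sym (LineGraph G) (parent-adjacent i v≢) }
      ; symm      = Tree-sym i
      ; connected = connected i
      ; acyclic   = acyclic i }

    -- If the child is the same in both trees, its parent would have two colours. If the roles are
    -- swapped, the two ends would be mutual parents.
    edge-disjoint : ∀ {i j e f} → i ≢ j → Tree i e f → Tree j e f → ⊥
    edge-disjoint {e = e} {f} i≢j (inj₁ (_ , p)) (inj₁ (_ , q)) = i≢j (upEdge-disjoint (top e) (top e) (trans p (sym q)))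
    edge-disjoint {e = e} {f} i≢j (inj₂ (_ , p)) (inj₂ (_ , q)) = i≢j (upEdge-disjoint (top f) (top f) (trans p (sym q)))
    edge-disjoint i≢j (inj₁ (_ , p)) (inj₂ (_ , q)) = no-mutual-parents i≢j p q
    edge-disjoint i≢j (inj₂ (_ , p)) (inj₁ (_ , q)) = no-mutual-parents i≢j p q

  completelyIndependentTrees : Σ (Fin k → Edge G → Edge G → Set) λ T → CompletelyIndependent (LineGraph G) T
  completelyIndependentTrees = Tree , spanningTree , λ i j i≢j u v _ p q path-p path-q →
    (λ x x∈p x∈q → internally-disjoint i≢j p q path-p path-q x∈p x∈q (x ≟ᵉ u) (x ≟ᵉ v)) ,
    (λ a b a∈p b∈q → edge-disjoint i≢j (used-edge i a∈p) (used-edge j b∈q))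
    where
    -- A common inner vertex would be a parent in both trees, hence an upward edge of both colours.
    internally-disjoint : ∀ {i j u v x} → i ≢ j → (p : Walk (Tree i) u v) (q : Walk (Tree j) u v) →
      IsPath p → IsPath q → x ∈ verts p → x ∈ verts q → Dec (x ≡ u) → Dec (x ≡ v) → x ≡ u ⊎ x ≡ v
    internally-disjoint _ _ _ _ _ _ _ (yes x≡u) _ = inj₁ x≡u
    internally-disjoint _ _ _ _ _ _ _ (no _) (yes x≡v) = inj₂ x≡v
    internally-disjoint {i} {j} i≢j p q path-p path-q x∈p x∈q (no x≢u) (no x≢v) =
      let y , py≡x = interior-is-parent i p path-p x∈p x≢u x≢v
          z , qz≡x = interior-is-parent j q path-q x∈q x≢u x≢v
      in contradiction (upEdge-disjoint (top y) (top z) (trans py≡x (sym qz≡x))) i≢j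

-- Choice of roots and assembly

degree-≤ : (G : SimpleGraph n) → ∀ v → degree G v ≤ n
degree-≤ {n} G v = begin
  degree G v               ≤⟨ ∑-mono (allFin n) (λ w → bool≤1 (adj G v w)) ⟩
  ∑ (allFin n) (λ _ → 1)   ≡⟨ trans (∑-one (allFin n)) (length-tabulate {n = n} id) ⟩
  n                        ∎
  where
  open ≤-Reasoning
  bool≤1 : ∀ b → boolToℕ b ≤ 1
  bool≤1 true  = ≤-refl
  bool≤1 false = z≤n

other : Fin (suc (suc k)) → Fin (suc (suc k))
other F.zero    = F.suc F.zero
other (F.suc _) = F.zero

other-≢ : (i : Fin (suc (suc k))) → other i ≢ i
other-≢ F.zero    ()
other-≢ (F.suc _) ()

theorem5 : ∀ (k : ℕ) → 2 ≤ k → ∀ (n : ℕ) (G : SimpleGraph n) →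
    KConnected (LineGraph G) (k * k + 2 * k ∸ 1) →
    MinDegree≥ G (k + 1) →
    Σ (Fin k → Edge G → Edge G → Set) λ T → CompletelyIndependent (LineGraph G) T
theorem5 (suc zero) (s≤s ())
-- The size clause of connectivity makes the list of edges nonempty, and an end `v` of its first
-- entry is the vertex that the packing starts from.
theorem5 (suc (suc k)) 2≤K n G conn@((((v , _) , _) ∷ _ , _) , _) δ =
  CompletelyIndependentTrees.completelyIndependentTrees G
    {E = λ i x y → (x , y) ∈ class i ⊎ (y , x) ∈ class i} E-adj E-sym E-disjoint
    r (λ {i} {j} → F.inject≤-injective K≤n K≤n i j) trees
  where
  K = suc (suc k)
  open Charging G
  open Packability G K 2≤K (K * K + 2 * K ∸ 1) (m∸n+n≡m {K * K + 2 * K} {1} (s≤s z≤n)) conn δ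
  packed : ∃ λ (D : Vec (Fin K) (length edgePairs)) → ∀ i → components (colourClass edgePairs D i ++ []) ≤ 1
  packed = packing v edgePairs (λ _ → []) (packable v)
  class : Fin K → List (Fin n × Fin n)
  class = colourClass edgePairs (proj₁ packed)
  class-edge : ∀ {i x y} → (x , y) ∈ class i → x F.< y × adj G x y ≡ true
  class-edge xy∈ = proj₂ (∈-filter⁻ isEdge? {xs = cartesianProduct (allFin n) (allFin n)}
                            (colourClass-⊆ edgePairs (proj₁ packed) xy∈))
  class-disjoint : ∀ {e i j} → e ∈ class i → e ∈ class j → i ≡ j
  class-disjoint = colourClass-disjoint (filter⁺ isEdge? (cartesianProduct⁺ (allFin⁺ n) (allFin⁺ n))) (proj₁ packed)
  E : Fin K → Fin n → Fin n → Set
  E i x y = (x , y) ∈ class i ⊎ (y , x) ∈ class i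
  E-adj : ∀ {i x y} → E i x y → adj G x y ≡ true
  E-adj (inj₁ xy∈) = proj₂ (class-edge xy∈)
  E-adj {x = x} {y} (inj₂ yx∈) = trans (adj-sym G x y) (proj₂ (class-edge yx∈))
  E-sym : ∀ {i x y} → E i x y → E i y x
  E-sym (inj₁ xy∈) = inj₂ xy∈
  E-sym (inj₂ yx∈) = inj₁ yx∈
  E-disjoint : ∀ {i j x y} → E i x y → E j x y → i ≡ j
  E-disjoint (inj₁ p) (inj₁ q) = class-disjoint p q
  E-disjoint (inj₂ p) (inj₂ q) = class-disjoint p q
  E-disjoint (inj₁ p) (inj₂ q) = contradiction (proj₁ (class-edge q)) (<-asym (proj₁ (class-edge p)))
  E-disjoint (inj₂ p) (inj₁ q) = contradiction (proj₁ (class-edge q)) (<-asym (proj₁ (class-edge p)))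
  E? : ∀ i x y → Dec (E i x y)
  E? i x y = Any.any? (≡-dec F._≟_ F._≟_ (x , y)) (class i) ⊎-dec Any.any? (≡-dec F._≟_ F._≟_ (y , x)) (class i)
  K≤n : K ≤ n
  K≤n = ≤-trans (m≤m+n K 1) (≤-trans (δ v) (degree-≤ G v))
  r : Fin K → Fin n
  -- The first `K` vertices serve as distinct roots; there are enough of them because the degree of
  -- `v` is at least K+1.
  r i = F.inject≤ i K≤n
  trees : ∀ i → RootedTree (E i) (r i)
  trees i = rootedTree (λ x → reachable (class i) inj₁ x
                (components-≤1⇒Joined (class i) (subst (λ L → components L ≤ 1) (++-identityʳ (class i)) (proj₂ packed i)) x (r i)))
              -- Another root is the second vertex from which a neighbour of `r i` is found; it
              -- exists because there are at least two colours.
              (r (other i)) (λ eq → other-≢ i (F.inject≤-injective K≤n K≤n (other i) i eq))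
    where open BreadthFirst (E? i) (λ {x} {y} → E-sym {i} {x} {y}) (r i)
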